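{- Let $\phi:\mathbb{P}_1\rightarrow\mathbb{P}_1$ be an endomorphism defined over $\mathbb{Q}$, with good reduction at every non-archimedean place of $\mathbb{Q}$. (1) If $P\in\mathbb{P}_1(\mathbb{Q})$ is a periodic point for $\phi$ with minimal period $n$, then $n\leq 3$. (2) If $P\in\mathbb{P}_1(\mathbb{Q})$ is a preperiodic point for $\phi$, then $|O_\phi(P)|\leq 12$.
   Context: For a prime number $p$, let $\mathbb{Z}_{(p)}$ be the localization of $\mathbb{Z}$ at $p$. An endomorphism $\phi$ of $\mathbb{P}_1$ defined over $\mathbb{Q}$ has good reduction at $p$ if it can be written as $\phi([x:y])=[F(x,y):G(x,y)]$, where $F,G$ are homogeneous polynomials of the same degree with coefficients in $\mathbb{Z}_{(p)}$ whose resultant $\mathrm{Res}(F,G)$ is a unit of $\mathbb{Z}_{(p)}$. A point $P$ is periodic for $\phi$ if $\phi^n(P)=P$ for some $n>0$; the minimal such $n$ is its minimal period. The forward orbit of $P$ is $O_\phi(P)=\{\phi^n(P)\mid n\in\mathbb{N}\}$ (with $\phi^0(P)=P$), and $P$ is preperiodic if $O_\phi(P)$ contains a periodic point, equivalently if $O_\phi(P)$ is finite. -}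

module Defs where

open import Algebra.Bundles using (CommutativeRing)
open import Data.Fin.Base using (Fin; zero; suc; toℕ; splitAt; punchIn)
open import Data.Nat.Base as ℕ using (ℕ; zero; suc; _∸_)
open import Data.Nat.Divisibility using (_∣_)
open import Data.Product.Base using (_×_; _,_; ∃-syntax; Σ-syntax; proj₁)
open import Data.Rational.Base using (ℚ; 0ℚ; 1ℚ; _+_; _*_; -_; 1/_; ↧ₙ_; ≢-nonZero)
open import Data.Rational.Properties
open import Data.Rational.Solver using (module +-*-Solver)
open import Data.Sum.Base using ([_,_]′)
open import Data.Vec.Functional using (Vector; tail)
open import Function.Base using (_∘_)
open import Function.Bundles using (Func; Bijection)
open import Level using (0ℓ)
open import Relation.Binary.Bundles using (Setoid)
open import Relation.Binary.PropositionalEquality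
import Relation.Binary.Construct.On as On
open import Relation.Nullary using (¬_; yes; no; contradiction)

open CommutativeRing +-*-commutativeRing using (semiring; commutativeSemiring)
open import Algebra.Properties.Semiring.Sum semiring
  using (sum; sum-syntax; sum⁺-syntax; sum-cong-≗; sum-replicate-zero; *-distribˡ-sum)
open import Algebra.Properties.CommutativeSemiring.Exp commutativeSemiring
  using (_^_; ^-distrib-*)

record Point : Set where
  constructor point
  field
    x y     : ℚ
    nonzero : ¬ (x ≡ 0ℚ × y ≡ 0ℚ)

infix 4 _∼_
_∼_ : Point → Point → Set
P ∼ Q = ∃[ c ] c ≢ 0ℚ × Point.x Q ≡ c * Point.x P × Point.y Q ≡ c * Point.y P

*-≢0 : ∀ {p q} → p ≢ 0ℚ → q ≢ 0ℚ → p * q ≢ 0ℚ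
*-≢0 {p} {q} p≢0 q≢0 pq≡0 = q≢0 (begin
  q                ≡⟨ *-identityˡ q ⟨
  1ℚ * q           ≡⟨ cong (_* q) (*-inverseˡ p) ⟨
  (1/ p) * p * q   ≡⟨ *-assoc (1/ p) p q ⟩
  (1/ p) * (p * q) ≡⟨ cong ((1/ p) *_) pq≡0 ⟩
  (1/ p) * 0ℚ      ≡⟨ *-zeroʳ (1/ p) ⟩
  0ℚ               ∎)
  where
  open ≡-Reasoning
  instance _ = ≢-nonZero p≢0

^-≢0 : ∀ {p} → p ≢ 0ℚ → ∀ n → p ^ n ≢ 0ℚ
^-≢0 p≢0 zero    = 1≢0
^-≢0 p≢0 (suc n) = *-≢0 p≢0 (^-≢0 p≢0 n)

ℙ¹ : Setoid 0ℓ 0ℓ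
ℙ¹ = record
  { Carrier       = Point
  ; _≈_           = _∼_
  ; isEquivalence = record
    { refl  = 1ℚ , 1≢0 , sym (*-identityˡ _) , sym (*-identityˡ _)
    ; sym   = λ {P} {Q} (c , c≢0 , eqx , eqy) → ∼-sym {P} {Q} c c≢0 eqx eqy
    ; trans = λ (c , c≢0 , eqx , eqy) (d , d≢0 , eqx′ , eqy′) →
        d * c , *-≢0 d≢0 c≢0 , step d c eqx eqx′ , step d c eqy eqy′
    }
  }
  where
  step : ∀ d c {u v w} → v ≡ c * u → w ≡ d * v → w ≡ d * c * u
  step d c refl refl = sym (*-assoc d c _)

  ∼-sym : ∀ {P Q} c → c ≢ 0ℚ → Point.x Q ≡ c * Point.x P → Point.y Q ≡ c * Point.y P → Q ∼ P
  ∼-sym c c≢0 eqx eqy = 1/ c , 1/c≢0 , undo eqx , undo eqy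
    where
    instance _ = ≢-nonZero c≢0
    1/c≢0 : 1/ c ≢ 0ℚ
    1/c≢0 eq = 1≢0 (trans (sym (*-inverseˡ c)) (trans (cong (_* c) eq) (*-zeroˡ c)))
    undo : ∀ {u v} → v ≡ c * u → u ≡ (1/ c) * v
    undo {u} refl = sym (trans (sym (*-assoc (1/ c) c u))
      (trans (cong (_* u) (*-inverseˡ c)) (*-identityˡ u)))

-- F : Form d stands for F(X,Y) = ∑_{i ≤ d} Fᵢ X^(d-i) Y^i.  The zero
-- polynomial is a form of every degree.
Form : ℕ → Set
Form d = Vector ℚ (suc d)

eval : ∀ {d} → Form d → ℚ → ℚ → ℚ
eval {d} F x y = ∑[ i ≤ d ] (F i * (x ^ (d ∸ toℕ i) * y ^ toℕ i))

-- Coefficients extended by 0 beyond the degree, so that forms whose degrees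
-- agree only propositionally can be compared.
coeff : ∀ {n} → Vector ℚ n → ℕ → ℚ
coeff {zero}  v k       = 0ℚ
coeff {suc n} v zero    = v zero
coeff {suc n} v (suc k) = coeff (tail v) k

infixl 7 _⋆_
_⋆_ : ∀ {m n} → Form m → Form n → ℕ → ℚ
(F ⋆ G) k = ∑[ j ≤ k ] (coeff F (toℕ j) * coeff G (k ∸ toℕ j))

infix 4 _∣ᶠ_
_∣ᶠ_ : ∀ {e d} → Form e → Form d → Set
_∣ᶠ_ {e} {d} H F = ∃[ n ] Σ[ A ∈ Form n ] (e ℕ.+ n ≡ d × (∀ k → coeff F k ≡ (H ⋆ A) k))

IsUnitForm : ∀ {e} → Form e → Set
IsUnitForm {e} H = e ≡ 0 × ∃[ i ] H i ≢ 0ℚ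

-- For d = 0 this says exactly that the constants F and G are not both zero;
-- for d ≥ 1 it rules out F = G = 0 as well, X being a common divisor.
CoprimeForms : ∀ {d} → Form d → Form d → Set
CoprimeForms F G = ∀ {e} (H : Form e) → H ∣ᶠ F → H ∣ᶠ G → IsUnitForm H

det : ∀ {n} → (Fin n → Fin n → ℚ) → ℚ
det {zero}  M = 1ℚ
det {suc n} M =
  ∑[ j ≤ n ] ((- 1ℚ) ^ toℕ j * (M zero j * det (λ r c → M (suc r) (punchIn j c))))

-- Coefficients of the vector preceded by i zeros.
shift : ℕ → (ℕ → ℚ) → ℕ → ℚ
shift zero    f k       = f k
shift (suc i) f zero    = 0ℚ
shift (suc i) f (suc k) = shift i f k

sylvester : ∀ {d} → Form d → Form d → Fin (d ℕ.+ d) → Fin (d ℕ.+ d) → ℚ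
sylvester {d} F G r c =
  [ (λ i → shift (toℕ i) (coeff F) (toℕ c))
  , (λ i → shift (toℕ i) (coeff G) (toℕ c))
  ]′ (splitAt d r)

Res : ∀ {d} → Form d → Form d → ℚ
Res F G = det (sylvester F G)

sum-zero : ∀ {n} (f : Vector ℚ n) → (∀ i → f i ≡ 0ℚ) → sum f ≡ 0ℚ
sum-zero {n} f f≡0 = trans (sum-cong-≗ f≡0) (sum-replicate-zero n)

eval-suc : ∀ {d} (F : Form (suc d)) x y →
           eval F x y ≡ F zero * x ^ suc d + y * eval (tail F) x y
eval-suc {d} F x y = cong₂ _+_
  (cong (F zero *_) (*-identityʳ (x ^ suc d)))
  (trans (sum-cong-≗ λ i → rearr (F (suc i)) (x ^ (d ∸ toℕ i)) y (y ^ toℕ i))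
         (sym (*-distribˡ-sum y λ i → F (suc i) * (x ^ (d ∸ toℕ i) * y ^ toℕ i))))
  where
  open +-*-Solver
  rearr : ∀ a b y c → a * (b * (y * c)) ≡ y * (a * (b * c))
  rearr = solve 4 (λ a b y c → a :* (b :* (y :* c)) := y :* (a :* (b :* c))) refl

linear : ℚ → ℚ → Form 1
linear a b zero    = a
linear a b (suc _) = b

linear-⋆-zero : ∀ {n} a b (A : Form n) → (linear a b ⋆ A) zero ≡ a * A zero
linear-⋆-zero a b A = +-identityʳ _

linear-⋆-suc : ∀ {n} a b (A : Form n) k →
               (linear a b ⋆ A) (suc k) ≡ a * coeff A (suc k) + b * coeff A k
linear-⋆-suc a b A k = cong (a * coeff A (suc k) +_)
  (trans (cong (b * coeff A k +_) (sum-zero rest λ i → *-zeroˡ (coeff A (k ∸ suc (toℕ i)))))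
         (+-identityʳ _))
  where
  rest : Vector ℚ k
  rest i = 0ℚ * coeff A (k ∸ suc (toℕ i))

-- Synthetic division by X - tY.
module Division (t : ℚ) where

  next : ∀ {d} → Form (suc d) → Form d
  next F zero    = F (suc zero) + t * F zero
  next F (suc i) = F (suc (suc i))

  quotient : ∀ {d} → Form (suc d) → Form d
  quotient         F zero    = F zero
  quotient {suc d} F (suc i) = quotient (next F) i

  remainder : ∀ {d} → Form d → ℚ
  remainder {zero}  F = F zero
  remainder {suc d} F = remainder (next F)

  eval-next : ∀ {d} (F : Form (suc d)) y →
              eval F (t * y) y ≡ y * eval (next F) (t * y) y
  eval-next {zero}  F y = lem (F zero) (F (suc zero)) t y
    where
    open +-*-Solver
    lem : ∀ a b t y → a * (t * y * 1ℚ * 1ℚ) + (b * (1ℚ * (y * 1ℚ)) + 0ℚ)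
                    ≡ y * ((b + t * a) * (1ℚ * 1ℚ) + 0ℚ)
    lem = solve 4 (λ a b t y →
      a :* (t :* y :* con 1ℚ :* con 1ℚ) :+ (b :* (con 1ℚ :* (y :* con 1ℚ)) :+ con 0ℚ)
      := y :* ((b :+ t :* a) :* (con 1ℚ :* con 1ℚ) :+ con 0ℚ)) refl
  eval-next {suc d} F y = begin
    eval F x y
      ≡⟨ eval-suc F x y ⟩
    F zero * (x * x ^ suc d) + y * eval (tail F) x y
      ≡⟨ cong (λ z → F zero * (x * x ^ suc d) + y * z) (eval-suc (tail F) x y) ⟩
    F zero * (x * x ^ suc d) + y * (F (suc zero) * x ^ suc d + y * e)
      ≡⟨ lem (F zero) (F (suc zero)) t y (x ^ suc d) (y * e) ⟩
    y * ((F (suc zero) + t * F zero) * x ^ suc d + y * e)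
      ≡⟨ cong (y *_) (eval-suc (next F) x y) ⟨
    y * eval (next F) x y ∎
    where
    open ≡-Reasoning
    open +-*-Solver
    x = t * y
    e = eval (tail (tail F)) x y
    lem : ∀ a b t y w e → a * (t * y * w) + y * (b * w + e) ≡ y * ((b + t * a) * w + e)
    lem = solve 6 (λ a b t y w e →
      a :* (t :* y :* w) :+ y :* (b :* w :+ e) := y :* ((b :+ t :* a) :* w :+ e)) refl

  remainder≡0 : ∀ {d} (F : Form d) {y} → y ≢ 0ℚ → eval F (t * y) y ≡ 0ℚ → remainder F ≡ 0ℚ
  remainder≡0 {zero} F y≢0 eq =
    trans (sym (trans (+-identityʳ _) (*-identityʳ (F zero)))) eq
  remainder≡0 {suc d} F {y} y≢0 eq with eval (next F) (t * y) y ≟ 0ℚ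
  ... | yes e≡0 = remainder≡0 (next F) y≢0 e≡0
  ... | no  e≢0 = contradiction (trans (sym (eval-next F y)) eq) (*-≢0 y≢0 e≢0)

  coeff-step : ∀ {d} (F : Form (suc d)) → remainder F ≡ 0ℚ → ∀ k →
               coeff F (suc k) ≡ 1ℚ * coeff (quotient F) (suc k) + (- t) * coeff (quotient F) k
  coeff-step {zero} F r≡0 zero = begin
    b                     ≡⟨ lem b t a ⟩
    b + t * a + (- t) * a ≡⟨ cong (_+ (- t) * a) r≡0 ⟩
    0ℚ + (- t) * a        ∎
    where
    open ≡-Reasoning
    open +-*-Solver
    a = F zero
    b = F (suc zero)
    lem : ∀ b t a → b ≡ b + t * a + (- t) * a
    lem = solve 3 (λ b t a → b := b :+ t :* a :+ (:- t) :* a) refl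
  coeff-step {zero} F r≡0 (suc k) = sym (trans (+-identityˡ ((- t) * 0ℚ)) (*-zeroʳ (- t)))
  coeff-step {suc d} F r≡0 zero = lem (F (suc zero)) t (F zero)
    where
    open +-*-Solver
    lem : ∀ b t a → b ≡ 1ℚ * (b + t * a) + (- t) * a
    lem = solve 3 (λ b t a → b := con 1ℚ :* (b :+ t :* a) :+ (:- t) :* a) refl
  coeff-step {suc d} F r≡0 (suc k) = coeff-step (next F) r≡0 k

  divides : ∀ {d} (F : Form (suc d)) {y} → y ≢ 0ℚ → eval F (t * y) y ≡ 0ℚ →
            linear 1ℚ (- t) ∣ᶠ F
  divides {d} F y≢0 eq = d , quotient F , refl , λ where
    zero    → sym (trans (linear-⋆-zero 1ℚ (- t) (quotient F)) (*-identityˡ (F zero)))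
    (suc k) → trans (coeff-step F (remainder≡0 F y≢0 eq) k)
                    (sym (linear-⋆-suc 1ℚ (- t) (quotient F) k))

Y-divides : ∀ {d} (F : Form (suc d)) {x} → x ≢ 0ℚ → eval F x 0ℚ ≡ 0ℚ → linear 0ℚ 1ℚ ∣ᶠ F
Y-divides {d} F {x} x≢0 eq = d , tail F , refl , λ where
    zero    → trans F₀≡0 (sym (trans (linear-⋆-zero 0ℚ 1ℚ (tail F)) (*-zeroˡ (tail F zero))))
    (suc k) → sym (trans (linear-⋆-suc 0ℚ 1ℚ (tail F) k) (lem (coeff (tail F) (suc k)) (coeff (tail F) k)))
  where
  open ≡-Reasoning
  lem : ∀ a b → 0ℚ * a + 1ℚ * b ≡ b
  lem a b = trans (cong₂ _+_ (*-zeroˡ a) (*-identityˡ b)) (+-identityˡ b)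

  F₀x≡0 : F zero * x ^ suc d ≡ 0ℚ
  F₀x≡0 = begin
    F zero * x ^ suc d                          ≡⟨ +-identityʳ _ ⟨
    F zero * x ^ suc d + 0ℚ                     ≡⟨ cong (F zero * x ^ suc d +_) (*-zeroˡ (eval (tail F) x 0ℚ)) ⟨
    F zero * x ^ suc d + 0ℚ * eval (tail F) x 0ℚ ≡⟨ eval-suc F x 0ℚ ⟨
    eval F x 0ℚ                                 ≡⟨ eq ⟩
    0ℚ                                          ∎

  F₀≡0 : F zero ≡ 0ℚ
  F₀≡0 with F zero ≟ 0ℚ
  ... | yes p = p
  ... | no ¬p = contradiction F₀x≡0 (*-≢0 ¬p (^-≢0 x≢0 (suc d)))

noCommonZero : ∀ {d} {F G : Form d} → CoprimeForms F G → ∀ {x y} → ¬ (x ≡ 0ℚ × y ≡ 0ℚ) →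
               ¬ (eval F x y ≡ 0ℚ × eval G x y ≡ 0ℚ)
noCommonZero {zero} {F} {G} cop {x} {y} nz (F≡0 , G≡0) = ¬zero-unit (cop (λ _ → 0ℚ) (zero∣ {x} {y} F F≡0) (zero∣ {x} {y} G G≡0))
  where
  ¬zero-unit : ¬ IsUnitForm {0} (λ _ → 0ℚ)
  ¬zero-unit (_ , _ , 0≢0) = 0≢0 refl

  coeff₀ : ∀ k → coeff {1} (λ _ → 0ℚ) k ≡ 0ℚ
  coeff₀ zero    = refl
  coeff₀ (suc k) = refl

  zero∣ : ∀ {x y} (E : Form 0) → eval E x y ≡ 0ℚ → (λ _ → 0ℚ) ∣ᶠ E
  zero∣ E E≡0 = 0 , (λ _ → 0ℚ) , refl , λ k → trans (coeff-E k) (sym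
    (sum-zero (λ (j : Fin (suc k)) → coeff {1} (λ _ → 0ℚ) (toℕ j) * coeff {1} (λ _ → 0ℚ) (k ∸ toℕ j))
      λ j → trans (cong (_* coeff {1} (λ _ → 0ℚ) (k ∸ toℕ j)) (coeff₀ (toℕ j))) (*-zeroˡ (coeff {1} (λ _ → 0ℚ) (k ∸ toℕ j)))))
    where
    coeff-E : ∀ k → coeff E k ≡ 0ℚ
    coeff-E zero    = trans (sym (trans (+-identityʳ _) (*-identityʳ (E zero)))) E≡0
    coeff-E (suc k) = refl
noCommonZero {suc d} {F} {G} cop {x} {y} nz (F≡0 , G≡0) with y ≟ 0ℚ
... | yes refl = contradiction
        (proj₁ (cop (linear 0ℚ 1ℚ) (Y-divides F x≢0 F≡0) (Y-divides G x≢0 G≡0))) λ ()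
  where
  x≢0 : x ≢ 0ℚ
  x≢0 x≡0 = nz (x≡0 , refl)
... | no y≢0 = contradiction
        (proj₁ (cop (linear 1ℚ (- t)) (divides F y≢0 (at-root F F≡0)) (divides G y≢0 (at-root G G≡0)))) λ ()
  where
  instance _ = ≢-nonZero y≢0
  t = x * (1/ y)
  open Division t
  ty≡x : t * y ≡ x
  ty≡x = trans (*-assoc x (1/ y) y) (trans (cong (x *_) (*-inverseˡ y)) (*-identityʳ x))
  at-root : ∀ (E : Form (suc d)) → eval E x y ≡ 0ℚ → eval E (t * y) y ≡ 0ℚ
  at-root E = subst (λ z → eval E z y ≡ 0ℚ) (sym ty≡x)

eval-scale : ∀ {d} (F : Form d) c x y → eval F (c * x) (c * y) ≡ c ^ d * eval F x y
eval-scale {zero} F c x y = sym (*-identityˡ _)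
eval-scale {suc d} F c x y = begin
  eval F (c * x) (c * y)
    ≡⟨ eval-suc F (c * x) (c * y) ⟩
  F zero * (c * x) ^ suc d + c * y * eval (tail F) (c * x) (c * y)
    ≡⟨ cong₂ (λ u v → F zero * u + c * y * v) (^-distrib-* c x (suc d)) (eval-scale (tail F) c x y) ⟩
  F zero * (c * c ^ d * x ^ suc d) + c * y * (c ^ d * eval (tail F) x y)
    ≡⟨ lem (F zero) c (c ^ d) (x ^ suc d) y (eval (tail F) x y) ⟩
  c * c ^ d * (F zero * x ^ suc d + y * eval (tail F) x y)
    ≡⟨ cong (c * c ^ d *_) (eval-suc F x y) ⟨
  c * c ^ d * eval F x y ∎
  where
  open ≡-Reasoning
  open +-*-Solver
  lem : ∀ a c k w y e → a * (c * k * w) + c * y * (k * e) ≡ c * k * (a * w + y * e)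
  lem = solve 6 (λ a c k w y e →
    a :* (c :* k :* w) :+ c :* y :* (k :* e) := c :* k :* (a :* w :+ y :* e)) refl

-- The endomorphism [F : G], constants (degree 0) included.  Coprimality over
-- ℚ amounts to having no common zero over an algebraic closure.
record Endomorphism : Set where
  field
    {degree} : ℕ
    F G      : Form degree
    coprime  : CoprimeForms F G

open Endomorphism using (F; G)

-- [F : G] and [F′ : G′] are the same morphism: F G′ = G F′ as polynomials.
infix 4 _≈ᴱ_
_≈ᴱ_ : Endomorphism → Endomorphism → Set
φ ≈ᴱ ψ = ∀ k → (F φ ⋆ G ψ) k ≡ (G φ ⋆ F ψ) k

⟦_⟧ : Endomorphism → Func ℙ¹ ℙ¹
⟦ φ ⟧ = record
  { to   = λ (point x y nz) →
      point (eval (F φ) x y) (eval (G φ) x y) (noCommonZero (Endomorphism.coprime φ) nz)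
  ; cong = λ { {point x y _} (c , c≢0 , refl , refl) →
      c ^ d , ^-≢0 c≢0 d , eval-scale (F φ) c x y , eval-scale (G φ) c x y }
  }
  where d = Endomorphism.degree φ

-- Membership in the subring ℤ₍ₚ₎ of ℚ; ↧ₙ q is the denominator of q in
-- lowest terms.
infix 4 _∈ℤ₍_₎
_∈ℤ₍_₎ : ℚ → ℕ → Set
q ∈ℤ₍ p ₎ = ¬ (p ∣ ↧ₙ q)

IsUnitℤ₍_₎ : ℕ → ℚ → Set
IsUnitℤ₍ p ₎ q = q ∈ℤ₍ p ₎ × ∃[ r ] (r ∈ℤ₍ p ₎ × q * r ≡ 1ℚ)

-- Asking the integral model ψ to be an Endomorphism matters only in degree 0,
-- where the resultant is the empty determinant 1 even for F = G = 0.
GoodReduction : Endomorphism → ℕ → Set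
GoodReduction φ p = Σ[ ψ ∈ Endomorphism ]
  ( φ ≈ᴱ ψ
  × (∀ i → F ψ i ∈ℤ₍ p ₎)
  × (∀ i → G ψ i ∈ℤ₍ p ₎)
  × IsUnitℤ₍ p ₎ (Res (F ψ) (G ψ)) )

import Function.Endo.Setoid ℙ¹ as Endo

iterate : Endomorphism → ℕ → Point → Point
iterate φ n = Func.to (⟦ φ ⟧ Endo.^ n)

record HasMinimalPeriod (φ : Endomorphism) (P : Point) (n : ℕ) : Set where
  field
    positive : 0 ℕ.< n
    returns  : iterate φ n P ∼ P
    minimal  : ∀ m → 0 ℕ.< m → iterate φ m P ∼ P → n ℕ.≤ m

Periodic : Endomorphism → Point → Set
Periodic φ P = ∃[ n ] (0 ℕ.< n × iterate φ n P ∼ P)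

_∈Orbit⟨_,_⟩ : Point → Endomorphism → Point → Set
Q ∈Orbit⟨ φ , P ⟩ = ∃[ n ] (iterate φ n P ∼ Q)

Preperiodic : Endomorphism → Point → Set
Preperiodic φ P = ∃[ Q ] (Q ∈Orbit⟨ φ , P ⟩ × Periodic φ Q)

-- The orbit as a subset of ℙ¹: points are compared in ℙ¹, whatever the
-- iterate that reaches them.
Orbit : Endomorphism → Point → Setoid 0ℓ 0ℓ
Orbit φ P = On.setoid {B = Σ[ Q ∈ Point ] Q ∈Orbit⟨ φ , P ⟩} ℙ¹ proj₁

HasCardinality : Setoid 0ℓ 0ℓ → ℕ → Set
HasCardinality S k = Bijection (setoid (Fin k)) S

{-# OPTIONS --safe #-}
module Submission where

-- Write points of ℙ¹(ℚ) as primitive integer vectors and let d(P , Q) be the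
-- absolute value of their cross product.  Good reduction at p says that the
-- p-part of d(P , Q) divides that of d(φP , φQ), so d(P , Q) ∣ d(φP , φQ).
-- Together with the ultrametric inequality at each prime and the Plücker
-- relation between the six cross products of four vectors this settles both
-- claims.  On a cycle of length n, d(Pᵢ , Pᵢ₊ₖ) depends on k only, and Plücker
-- relations exclude n = 4, 6, 9 and all n > 1 prime to 6; passing to iterates
-- leaves n ≤ 3.  On a tail ending in a fixed point Q, d(Pᵢ , Pⱼ) = d(Pᵢ , Q)
-- for i < j, and the Plücker relations with Q allow at most three points before
-- Q.  Applied to φⁿ, n the period, this gives at most 3n + n ≤ 12 points.

open import Defs
open import Algebra.Bundles using (CommutativeRing)
open import Data.Fin.Base using (Fin; zero; suc; toℕ; inject₁; punchIn; punchOut; fromℕ; fromℕ<; splitAt)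
import Data.Fin.Properties as Fin
open import Data.List.Base using ([]; _∷_)
open import Data.List.Relation.Unary.All using (_∷_)
open import Data.Nat.Base as ℕ using (ℕ; zero; suc; z≤n; s≤s; s≤s⁻¹; _≤_)
import Data.Nat.Coprimality as ℕ
import Data.Nat.Divisibility as ℕ
open import Data.Nat.GCD using (gcd; gcd[m,n]∣m; gcd[m,n]∣n; gcd[m,n]≡0⇒m≡0; gcd[m,n]≡0⇒n≡0; gcd-GCD; module Bézout)
open import Data.Nat.Induction using (<-rec)
open import Data.Nat.ListAction using (product)
open import Data.Nat.Primality using (Prime; euclidsLemma; prime⇒nonTrivial; prime[2])
open import Data.Nat.Primality.Factorisation using (factorise)
import Data.Nat.Properties as ℕ
open import Data.Product.Base using (_×_; _,_; ∃-syntax; proj₁; proj₂)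
import Data.Rational.Unnormalised.Base as ℚᵘ
import Data.Rational.Unnormalised.Properties as ℚᵘ
open import Data.Sum.Base using (_⊎_; inj₁; inj₂; [_,_]′)
open import Data.Vec.Functional using (Vector; tail)
open import Function.Base using (_∘_)
open import Function.Bundles using (Func)
open import Relation.Binary.Bundles using (Setoid)
open import Relation.Binary.Definitions using (tri<; tri≈; tri>)
open import Relation.Binary.PropositionalEquality
open import Relation.Nullary using (¬_; yes; no; contradiction)

-- Orbits in terms of their distances

-- Once absolute values are taken, the Plücker relation loses its signs: all that remains is that
-- one of three products is the sum of the other two (`Balanced`). This suffices because two equal
-- terms force the third to be their double or 0, and because on a cycle the distances become small
-- numbers after division by the distance of neighbours. Divisibility replaces valuations: `ultra`
-- for arbitrary `g` is the ultrametric inequality at all primes at once, and equality of points is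
-- distance 0, the number divisible by everything, so equalities propagate by the same rules as
-- divisibilities. The integral model of φ may change with the prime, so the divisibility of cross
-- products is not proved with one integral map: their quotient is one rational number, shown to lie
-- in every ℤ₍ₚ₎. The unit resultant enters by contraposition: an ideal containing the values of F
-- and G at a point would contain the resultant. This is read off a single column of the Sylvester
-- matrix.

module Dynamics where

  open import Data.Empty using (⊥; ⊥-elim)
  open import Data.Nat.Base using (z<s; s<s; _<_; _+_; _*_; ≢-nonZero; >-nonZero)
  open import Data.Nat.Divisibility
  open import Data.Nat.DivMod using (_%_; _/_; m≡m%n+[m/n]*n; m%n<n)
  open import Data.Nat.Properties
  open import Data.Nat.Solver using (module +-*-Solver)
  open import Relation.Nullary using (Dec)
  open import Relation.Unary using (Pred; Decidable)

  -- The trace left on absolute values by a relation ±x ± y ± z = 0 between integers.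
  Balanced : ℕ → ℕ → ℕ → Set
  Balanced x y z = x ≡ y + z ⊎ y ≡ x + z ⊎ z ≡ x + y

  Balanced-cong : ∀ {x x′ y y′ z z′} → x ≡ x′ → y ≡ y′ → z ≡ z′ → Balanced x y z → Balanced x′ y′ z′
  Balanced-cong refl refl refl b = b

  Balanced-cancelʳ : ∀ {x y z} k → k ≢ 0 → Balanced (x * k) (y * k) (z * k) → Balanced x y z
  Balanced-cancelʳ {x} {y} {z} k k≢0 = λ where
      (inj₁ eq)        → inj₁ (cancel x y z eq)
      (inj₂ (inj₁ eq)) → inj₂ (inj₁ (cancel y x z eq))
      (inj₂ (inj₂ eq)) → inj₂ (inj₂ (cancel z x y eq))
    where
    instance _ = ≢-nonZero k≢0
    cancel : ∀ a b c → a * k ≡ b * k + c * k → a ≡ b + c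
    cancel a b c eq = *-cancelʳ-≡ a (b + c) k (trans eq (sym (*-distribʳ-+ k b c)))

  x≡y+x⇒y≡0 : ∀ {x} y → x ≡ y + x → y ≡ 0
  x≡y+x⇒y≡0 {x} y eq = +-cancelʳ-≡ x y 0 (sym eq)

  Balanced-isosceles : ∀ {x y} → Balanced x y x → y ≢ 0 → y ≡ x + x
  Balanced-isosceles {x} {y} (inj₁ eq)        y≢0 = contradiction (x≡y+x⇒y≡0 y eq) y≢0
  Balanced-isosceles {x} {y} (inj₂ (inj₁ eq)) y≢0 = eq
  Balanced-isosceles {x} {y} (inj₂ (inj₂ eq)) y≢0 = contradiction (x≡y+x⇒y≡0 y (trans eq (+-comm x y))) y≢0

  ¬Balanced-equilateral : ∀ {x} → x ≢ 0 → ¬ Balanced x x x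
  ¬Balanced-equilateral {x} x≢0 b = x≢0 (x≡y+x⇒y≡0 x (Balanced-isosceles b x≢0))

  -- With `g` = 0, `ultra` is transitivity of equality, and `step` at distance 0 says that equal
  -- points have equal images.
  record IsDistance (d : ℕ → ℕ → ℕ) : Set where
    field
      diagonal : ∀ i → d i i ≡ 0
      symmetry : ∀ i j → d i j ≡ d j i
      ultra    : ∀ {g} i j k → g ∣ d i j → g ∣ d j k → g ∣ d i k
      plücker  : ∀ i j k l → Balanced (d i j * d k l) (d i k * d j l) (d i l * d j k)
      step     : ∀ i j → d i j ∣ d (suc i) (suc j)

  module Distance {d : ℕ → ℕ → ℕ} (isDistance : IsDistance d) where
    open IsDistance isDistance public

    shift-∣ : ∀ k i j → d i j ∣ d (k + i) (k + j)
    shift-∣ zero    i j = ∣-refl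
    shift-∣ (suc k) i j = ∣-trans (shift-∣ k i j) (step (k + i) (k + j))

    shift-≡0 : ∀ k {i j} → d i j ≡ 0 → d (k + i) (k + j) ≡ 0
    shift-≡0 k {i} {j} eq = 0∣⇒≡0 (subst (_∣ d (k + i) (k + j)) eq (shift-∣ k i j))

    trans-≡0 : ∀ i j k → d i j ≡ 0 → d j k ≡ 0 → d i k ≡ 0
    trans-≡0 i j k p q = 0∣⇒≡0 (ultra i j k (∣-reflexive (sym p)) (∣-reflexive (sym q)))

    -- Since 0 is divisible by everything, `ultra` makes each of the two distances divide the other.
    replaceˡ : ∀ {i j} k → d i j ≡ 0 → d i k ≡ d j k
    replaceˡ {i} {j} k eq = ∣-antisym
      (ultra j i k (subst (d i k ∣_) (sym (trans (symmetry j i) eq)) (d i k ∣0)) ∣-refl)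
      (ultra i j k (subst (d j k ∣_) (sym eq) (d j k ∣0)) ∣-refl)

    replaceʳ : ∀ {i j} k → d i j ≡ 0 → d k i ≡ d k j
    replaceʳ {i} {j} k eq = trans (symmetry k i) (trans (replaceˡ k eq) (symmetry j k))

    -- A long jump is cut into jumps of length `k`, all of them translates of the first; `ultra`
    -- puts them together.
    shift-mult-∣ : ∀ i k m → d i (i + k) ∣ d i (i + m * k)
    shift-mult-∣ i k zero    = subst (d i (i + k) ∣_) (sym (trans (cong (d i) (+-identityʳ i)) (diagonal i))) (_ ∣0)
    shift-mult-∣ i k (suc m) = ultra i (i + k) (i + (k + m * k)) ∣-refl
      (subst₂ (λ x y → d i (i + k) ∣ d x y) (+-comm k i)
        (trans (sym (+-assoc k i (m * k))) (trans (cong (_+ m * k) (+-comm k i)) (+-assoc i k (m * k))))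
        (∣-trans (shift-mult-∣ i k m) (shift-∣ k i (i + m * k))))

  -- Replaces the map by its `n`-th iterate and the initial point by the `s`-th one.
  isDistance-subsequence : ∀ {d} → IsDistance d → ∀ s n → IsDistance (λ i j → d (s + i * n) (s + j * n))
  isDistance-subsequence {d} isDistance s n = record
    { diagonal = λ i → diagonal _
    ; symmetry = λ i j → symmetry _ _
    ; ultra    = λ i j k → ultra _ _ _
    ; plücker  = λ i j k l → plücker _ _ _ _
    ; step     = λ i j → subst₂ (λ x y → d (s + i * n) (s + j * n) ∣ d x y) (eq i) (eq j)
                           (shift-∣ n (s + i * n) (s + j * n))
    }
    where
    open Distance isDistance
    open +-*-Solver
    eq : ∀ i → n + (s + i * n) ≡ s + (n + i * n)
    eq i = solve 3 (λ n s t → n :+ (s :+ t) := s :+ (n :+ t)) refl n s (i * n)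

  -- Distances on a cycle and the possible periods

  record IsCycle (d : ℕ → ℕ → ℕ) (n : ℕ) : Set where
    field
      returns : d 0 n ≡ 0
      minimal : ∀ {m} → 0 < m → m < n → d 0 m ≢ 0

  module Cycle {d : ℕ → ℕ → ℕ} (isDistance : IsDistance d)
               {n-1 : ℕ} (isCycle : IsCycle d (suc n-1)) (1<n : 1 < suc n-1) where
    open Distance isDistance
    open IsCycle isCycle

    private
      n = suc n-1

    e : ℕ → ℕ
    e = d 0

    e-return : ∀ k m → d k (k + m * n) ≡ 0
    e-return k m = 0∣⇒≡0 (subst (_∣ d k (k + m * n))
      (trans (cong (λ i → d i (k + n)) (sym (+-identityʳ k))) (shift-≡0 k returns)) (shift-mult-∣ k n m))

    -- Translation by i gives one divisibility; a further translation by
    -- i * (n - 1) moves i to i * n, back to the start, and gives the converse.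
    e-homogeneous : ∀ i k → d i (i + k) ≡ e k
    e-homogeneous i k = ∣-antisym
      (subst (d i (i + k) ∣_) around (shift-∣ (i * n-1) i (i + k)))
      (subst (λ j → e k ∣ d j (i + k)) (+-identityʳ i) (shift-∣ i 0 k))
      where
      open ≡-Reasoning
      eq : i * n-1 + i ≡ i * n
      eq = trans (+-comm (i * n-1) i) (sym (*-suc i n-1))
      around : d (i * n-1 + i) (i * n-1 + (i + k)) ≡ e k
      around = begin
        d (i * n-1 + i) (i * n-1 + (i + k)) ≡⟨ cong₂ d eq (trans (sym (+-assoc (i * n-1) i k)) (trans (cong (_+ k) eq) (+-comm (i * n) k))) ⟩
        d (i * n) (k + i * n)               ≡⟨ replaceˡ _ (e-return 0 i) ⟨
        d 0 (k + i * n)                     ≡⟨ replaceʳ 0 (e-return k i) ⟨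
        d 0 k                               ∎

    e-mult : ∀ m k → e k ∣ e (m * k)
    e-mult m k = shift-mult-∣ 0 k m

    e-1∣ : ∀ k → e 1 ∣ e k
    e-1∣ k = subst (λ j → e 1 ∣ e j) (*-identityʳ k) (e-mult k 1)

    e-reflect : ∀ k l → l + k ≡ n → e k ≡ e l
    e-reflect k l l+k≡n = begin
      e k         ≡⟨ e-homogeneous l k ⟨
      d l (l + k) ≡⟨ cong (d l) l+k≡n ⟩
      d l n       ≡⟨ replaceʳ l returns ⟨
      d l 0       ≡⟨ symmetry l 0 ⟩
      e l         ∎
      where open ≡-Reasoning

    -- If `k` is invertible modulo `n`, the jump by 1 is a repetition of the jump by `k`, so `e k`
    -- and `e 1` divide each other.
    e-unit : ∀ k m s → m * k ≡ 1 + s * n → e k ≡ e 1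
    e-unit k m s eq = ∣-antisym
      (subst (e k ∣_) (trans (cong e eq) (sym (replaceʳ 0 (e-return 1 s)))) (e-mult m k))
      (e-1∣ k)

    -- Normalised so that neighbours have distance 1; the Plücker relations, homogeneous of degree
    -- 2, survive the division.
    f : ℕ → ℕ
    f k = quotient (e-1∣ k)

    e≡f*e1 : ∀ k → e k ≡ f k * e 1
    e≡f*e1 k = _∣_.equality (e-1∣ k)

    private
      e1≢0 : e 1 ≢ 0
      e1≢0 = minimal z<s 1<n

      instance _ = ≢-nonZero e1≢0

    f-cong : ∀ {k l} → e k ≡ e l → f k ≡ f l
    f-cong {k} {l} eq = *-cancelʳ-≡ (f k) (f l) (e 1)
      (trans (sym (e≡f*e1 k)) (trans eq (e≡f*e1 l)))

    f-1 : f 1 ≡ 1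
    f-1 = *-cancelʳ-≡ (f 1) 1 (e 1) (trans (sym (e≡f*e1 1)) (sym (*-identityˡ (e 1))))

    f≡1 : ∀ {k} → e k ≡ e 1 → f k ≡ 1
    f≡1 eq = trans (f-cong eq) f-1

    f≢0 : ∀ {k} → 0 < k → k < n → f k ≢ 0
    f≢0 {k} 0<k k<n f≡0 = minimal 0<k k<n (trans (e≡f*e1 k) (cong (_* e 1) f≡0))

    -- Four points on the cycle with successive gaps `a`, `b`, `c`.
    f-plücker : ∀ a b c → Balanced (f a * f c) (f (a + b) * f (b + c)) (f (a + (b + c)) * f b)
    f-plücker a b c = Balanced-cancelʳ (e 1 * e 1) (λ p → e1≢0 (m*n≡0⇒m≡0 (e 1) (e 1) p))
      (Balanced-cong
        (factor a c refl (trans (cong (d (a + b)) (sym (+-assoc a b c))) (e-homogeneous (a + b) c)))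
        (factor (a + b) (b + c) refl (e-homogeneous a (b + c)))
        (factor (a + (b + c)) b refl (e-homogeneous a b))
        (plücker 0 a (a + b) (a + (b + c))))
      where
      open +-*-Solver
      factor : ∀ k l {x y} → x ≡ e k → y ≡ e l → x * y ≡ f k * f l * (e 1 * e 1)
      factor k l refl refl = trans (cong₂ _*_ (e≡f*e1 k) (e≡f*e1 l))
        (solve 3 (λ s t u → s :* u :* (t :* u) := s :* t :* (u :* u)) refl (f k) (f l) (e 1))

    -- Four consecutive points would have all three products equal to 1.
    coprime-6⇒⊥ : f 2 ≡ 1 → f 3 ≡ 1 → ⊥
    coprime-6⇒⊥ f2 f3 = ¬Balanced-equilateral {1} (λ ())
      (Balanced-cong (cong₂ _*_ f-1 f-1) (cong₂ _*_ f2 f2) (cong₂ _*_ f3 f-1) (f-plücker 1 1 1))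

  4≤[2+q]² : ∀ q → 4 ≤ (2 + q) * (2 + q)
  4≤[2+q]² q = *-mono-≤ (m≤m+n 2 q) (m≤m+n 2 q)

  q²≢2 : ∀ q → q * q ≢ 2
  q²≢2 0 ()
  q²≢2 1 ()
  q²≢2 (suc (suc q)) eq = contradiction (≤-trans (4≤[2+q]² q) (≤-reflexive eq)) λ { (s≤s (s≤s ())) }

  -- By reflection the gaps 3 and 1 have the same distance, so four consecutive points give (f 2)² =
  -- 1 + 1.
  ¬4-cycle : ∀ {d} → IsDistance d → ¬ IsCycle d 4
  ¬4-cycle isDistance isCycle = q²≢2 (f 2)
    (Balanced-isosceles
      (Balanced-cong (cong₂ _*_ f-1 f-1) refl (cong₂ _*_ (f≡1 (e-reflect 3 1 refl)) f-1) (f-plücker 1 1 1))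
      (λ p → f2≢0 (m*m≡0 p)))
    where
    open Cycle isDistance isCycle (s<s z<s)
    f2≢0 = f≢0 {2} z<s (s<s (s<s z<s))
    m*m≡0 : f 2 * f 2 ≡ 0 → f 2 ≡ 0
    m*m≡0 p with m*n≡0⇒m≡0∨n≡0 (f 2) p
    ... | inj₁ q = q
    ... | inj₂ q = q

  -- Gaps 1, 1, 2 with f 4 = f 2 cancelled give f 3 = 2. Gaps 1, 1, 1 then relate 1, (f 2)² and 2,
  -- so f 2 = 1. Gaps 2, 1, 2 finally relate 1, 4 and 1, which is impossible.
  ¬6-cycle : ∀ {d} → IsDistance d → ¬ IsCycle d 6
  ¬6-cycle isDistance isCycle = no-1-4-1
    (Balanced-cong (cong₂ _*_ f2≡1 f2≡1) (cong₂ _*_ f3≡2 f3≡2) (cong₂ _*_ f5≡1 f-1) (f-plücker 2 1 2))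
    where
    open Cycle isDistance isCycle (s<s z<s)
    f2≢0 : f 2 ≢ 0
    f2≢0 = f≢0 z<s (s<s (s<s z<s))
    f3≢0 : f 3 ≢ 0
    f3≢0 = f≢0 z<s (s<s (s<s (s<s z<s)))
    f5≡1 : f 5 ≡ 1
    f5≡1 = f≡1 (e-reflect 5 1 refl)
    f3≡2 : f 3 ≡ 2
    f3≡2 = Balanced-isosceles (Balanced-cancelʳ {1} {f 3} {1} (f 2) f2≢0
      (Balanced-cong (cong (_* f 2) f-1) (*-comm (f 2) (f 3))
        (trans (cong₂ _*_ (f-cong (e-reflect 4 2 refl)) f-1) (*-comm (f 2) 1))
        (f-plücker 1 1 2)))
      f3≢0
    no-1-4-1 : ¬ Balanced 1 4 1
    no-1-4-1 (inj₁ ())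
    no-1-4-1 (inj₂ (inj₁ ()))
    no-1-4-1 (inj₂ (inj₂ ()))
    root : ∀ q → q ≢ 0 → Balanced 1 (q * q) 2 → q ≡ 1
    root 0 q≢0 b = contradiction refl q≢0
    root 1 q≢0 b = refl
    root (suc (suc q)) q≢0 b = contradiction b λ where
      (inj₁ eq)        → contradiction (≤-trans (m≤n+m 2 ((2 + q) * (2 + q))) (≤-reflexive (sym eq))) λ { (s≤s ()) }
      (inj₂ (inj₁ eq)) → contradiction (≤-trans (4≤[2+q]² q) (≤-reflexive eq)) λ { (s≤s (s≤s (s≤s ()))) }
      (inj₂ (inj₂ eq)) → contradiction (≤-trans (s≤s (4≤[2+q]² q)) (≤-reflexive (sym eq))) λ { (s≤s (s≤s ())) }
    f2≡1 : f 2 ≡ 1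
    f2≡1 = root (f 2) f2≢0
      (Balanced-cong (cong₂ _*_ f-1 f-1) refl (cong₂ _*_ f3≡2 f-1) (f-plücker 1 1 1))

  -- Modulo 9 the gaps 2 and 5 are inverse to each other, so both have distance 1. Gaps 1, 1, 1 then
  -- force f 3 = 2, and f 6 = f 3 by reflection, so gaps 1, 2, 3 relate 2, 2 and 2.
  ¬9-cycle : ∀ {d} → IsDistance d → ¬ IsCycle d 9
  ¬9-cycle isDistance isCycle = ¬Balanced-equilateral {2} (λ ())
    (Balanced-cong (cong₂ _*_ f-1 f3≡2) (cong₂ _*_ f3≡2 f5≡1)
      (cong₂ _*_ (trans (f-cong (e-reflect 6 3 refl)) f3≡2) f2≡1) (f-plücker 1 2 3))
    where
    open Cycle isDistance isCycle (s<s z<s)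
    f2≡1 : f 2 ≡ 1
    f2≡1 = f≡1 (e-unit 2 5 1 refl)
    f5≡1 : f 5 ≡ 1
    f5≡1 = f≡1 (e-unit 5 2 1 refl)
    f3≢0 : f 3 ≢ 0
    f3≢0 = f≢0 z<s (s<s (s<s (s<s z<s)))
    equal : ∀ {q} → Balanced 1 1 q → q ≢ 0 → q ≡ 2
    equal (inj₁ eq) q≢0        = contradiction (sym (suc-injective eq)) q≢0
    equal (inj₂ (inj₁ eq)) q≢0 = contradiction (sym (suc-injective eq)) q≢0
    equal (inj₂ (inj₂ eq)) q≢0 = eq
    f3≡2 : f 3 ≡ 2
    f3≡2 = equal (Balanced-cong (cong₂ _*_ f-1 f-1) (cong₂ _*_ f2≡1 f2≡1)
      (trans (cong (f 3 *_) f-1) (*-identityʳ (f 3))) (f-plücker 1 1 1)) f3≢0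

  -- Both 2 and 3 are invertible modulo `n`, so for `n` > 1 the gaps 1, 2, 3 would all have distance
  -- `e 1`.
  coprime-6-cycle : ∀ {d n} → IsDistance d → IsCycle d n → ¬ 2 ∣ n → ¬ 3 ∣ n → n ≡ 1
  coprime-6-cycle {n = 0} isDistance isCycle 2∤n 3∤n = contradiction (2 ∣0) 2∤n
  coprime-6-cycle {n = 1} isDistance isCycle 2∤n 3∤n = refl
  coprime-6-cycle {n = n@(suc (suc _))} isDistance isCycle 2∤n 3∤n =
    ⊥-elim (coprime-6⇒⊥ f2≡1 f3≡1)
    where
    open Cycle isDistance isCycle (s<s z<s)
    f2≡1 : f 2 ≡ 1
    f2≡1 with n % 2 | n / 2 | m≡m%n+[m/n]*n n 2 | m%n<n n 2
    ... | 0 | m | eq | _ = contradiction (divides m eq) 2∤n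
    ... | 1 | m | eq | _ = f≡1 (e-unit 2 (suc m) 1
            (trans (cong suc (sym eq)) (sym (cong suc (+-identityʳ n)))))
    ... | suc (suc _) | m | eq | s<s (s<s ())
    f3≡1 : f 3 ≡ 1
    f3≡1 with n % 3 | n / 3 | m≡m%n+[m/n]*n n 3 | m%n<n n 3
    ... | 0 | m | eq | _ = contradiction (divides m eq) 3∤n
    -- Here n = 1 + 3m and the inverse of 3 is -m, which is negative; instead the multiple 3m is
    -- reflected to the gap 1.
    ... | 1 | m | eq | _ = f≡1 (∣-antisym
            (subst (e 3 ∣_) (e-reflect (m * 3) 1 (sym eq)) (e-mult m 3)) (e-1∣ 3))
    ... | 2 | m | eq | _ = f≡1 (e-unit 3 (suc m) 1
            (trans (cong suc (sym eq)) (sym (cong suc (+-identityʳ n)))))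
    ... | suc (suc (suc _)) | m | eq | s<s (s<s (s<s ()))

  isCycle-subsequence : ∀ {d n} k m → 0 < k → 0 < n → n ≡ m * k → IsCycle d n →
                        IsCycle (λ i j → d (i * k) (j * k)) m
  isCycle-subsequence {d} k m 0<k 0<n refl isCycle = record
    { returns = returns
    ; minimal = λ {i} 0<i i<m → minimal (*-mono-≤ 0<i 0<k) (*-monoˡ-< k i<m)
    }
    where
    open IsCycle isCycle
    instance _ = >-nonZero 0<k

  -- Write n = m * k with k = 2 for even n, k = 3 for odd multiples of 3, and k = 1 otherwise. The
  -- excluded lengths 4, 6 and 9 make m prime to 6, and the `k`-th iterate has a cycle of length m,
  -- so m = 1 and n = k.
  period≤3 : ∀ {d n} → IsDistance d → 0 < n → IsCycle d n → n ≤ 3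
  period≤3 {d} {n} isDistance 0<n isCycle = by-divisibility (2 ∣? n) (3 ∣? n)
    where
    open +-*-Solver

    subcycle : ∀ m k → n ≡ m * k → IsDistance (λ i j → d (i * k) (j * k)) × IsCycle (λ i j → d (i * k) (j * k)) m
    subcycle m zero    n≡0 = contradiction (trans n≡0 (*-zeroʳ m)) (m<n⇒n≢0 0<n)
    subcycle m (suc k) n≡  = isDistance-subsequence isDistance 0 (suc k) ,
                             isCycle-subsequence (suc k) m z<s 0<n n≡ isCycle

    excluded : ∀ m → (∀ {d} → IsDistance d → ¬ IsCycle d m) → ∀ k → ¬ n ≡ m * k
    excluded m ¬cycle k n≡ = let isD , isC = subcycle m k n≡ in ¬cycle isD isC

    coprime-part : ∀ m k → n ≡ m * k → ¬ 2 ∣ m → ¬ 3 ∣ m → k ≤ 3 → n ≤ 3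
    coprime-part m k n≡ 2∤m 3∤m k≤3 = let isD , isC = subcycle m k n≡ in
      ≤-trans (≤-reflexive (trans n≡ (trans (cong (_* k) (coprime-6-cycle isD isC 2∤m 3∤m)) (*-identityˡ k)))) k≤3

    regroup : ∀ q a b → q * a * b ≡ (b * a) * q
    regroup = solve 3 (λ q a b → q :* a :* b := (b :* a) :* q) refl

    by-divisibility : Dec (2 ∣ n) → Dec (3 ∣ n) → n ≤ 3
    by-divisibility (yes (divides m n≡2m)) _ = coprime-part m 2 n≡2m
      (λ { (divides q refl) → excluded 4 ¬4-cycle q (trans n≡2m (regroup q 2 2)) })
      (λ { (divides q refl) → excluded 6 ¬6-cycle q (trans n≡2m (regroup q 3 2)) })
      (s≤s (s≤s z≤n))
    by-divisibility (no 2∤n) (yes (divides m n≡3m)) = coprime-part m 3 n≡3m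
      (λ 2∣m → 2∤n (subst (2 ∣_) (sym n≡3m) (∣m⇒∣m*n 3 2∣m)))
      (λ { (divides q refl) → excluded 9 ¬9-cycle q (trans n≡3m (regroup q 3 3)) })
      ≤-refl
    by-divisibility (no 2∤n) (no 3∤n) = coprime-part n 1 (sym (*-identityʳ n)) 2∤n 3∤n (s≤s z≤n)

  -- Tails ending in a fixed point

  module Tail {d : ℕ → ℕ → ℕ} (isDistance : IsDistance d) where
    open Distance isDistance

    module _ (N : ℕ) (fixed : d N (suc N) ≡ 0) where

      fixed-beyond : ∀ k → d N (N + k) ≡ 0
      fixed-beyond zero    = trans (cong (d N) (+-identityʳ N)) (diagonal N)
      fixed-beyond (suc k) = trans-≡0 N (N + k) (N + suc k) (fixed-beyond k)
        (subst₂ (λ x y → d x y ≡ 0) (+-comm k N) (trans (+-suc k N) (trans (cong suc (+-comm k N)) (sym (+-suc N k))))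
          (shift-≡0 k fixed))

      δ : ℕ → ℕ
      δ i = d i N

      -- One application of the map moves the tail point but not the fixed point.
      δ-∣-suc : ∀ i → δ i ∣ δ (suc i)
      δ-∣-suc i = subst (δ i ∣_) (sym (replaceʳ (suc i) fixed)) (step i N)

      δ-∣ : ∀ i k → δ i ∣ δ (k + i)
      δ-∣ i zero    = ∣-refl
      δ-∣ i (suc k) = ∣-trans (δ-∣ i k) (δ-∣-suc (k + i))

      -- Repeating the jump by `suc k` often enough reaches the fixed point, so the distance divides
      -- `δ i`. Conversely `δ i` divides the distances of both points to the fixed point, hence
      -- their mutual distance.
      d≡δ : ∀ i k → d i (i + suc k) ≡ δ i
      d≡δ i k = ∣-antisym
        (subst (d i (i + suc k) ∣_) (trans (cong (d i) rearrange) (sym (replaceʳ i (fixed-beyond (N * k + i)))))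
          (shift-mult-∣ i (suc k) N))
        (ultra i N (i + suc k) ∣-refl
          (subst (δ i ∣_) (trans (cong δ (+-comm (suc k) i)) (symmetry (i + suc k) N)) (δ-∣ i (suc k))))
        where
        open +-*-Solver
        -- `N` jumps are enough, each having length at least 1.
        rearrange : i + N * suc k ≡ N + (N * k + i)
        rearrange = solve 3 (λ i n k → i :+ n :* (con 1 :+ k) := n :+ (n :* k :+ i)) refl i N k

      -- The Plücker relation for three points of the tail and the fixed point.
      δ-doubles : ∀ i j k → δ i ≢ 0 → δ (i + suc j + suc k) ≢ 0 →
                  δ (i + suc j + suc k) ≡ δ (i + suc j) + δ (i + suc j)
      δ-doubles i j k δi≢0 δl≢0 = Balanced-isosceles
        (Balanced-cancelʳ {δ m} {δ l} {δ m} (δ i) δi≢0 (swap (Balanced-cong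
          (trans (cong (_* δ l) (d≡δ i j)) (*-comm (δ i) (δ l)))
          (trans (cong (λ x → x * δ m) (trans (cong (d i) (+-assoc i (suc j) (suc k))) (d≡δ i (j + suc k)))) (*-comm (δ i) (δ m)))
          (trans (cong (δ i *_) (d≡δ m k)) (*-comm (δ i) (δ m)))
          (plücker i m l N)))) δl≢0
        where
        m = i + suc j
        l = i + suc j + suc k
        swap : ∀ {x y z} → Balanced x y z → Balanced y x z
        swap (inj₁ eq)        = inj₂ (inj₁ eq)
        swap (inj₂ (inj₁ eq)) = inj₁ eq
        swap {x} {y} (inj₂ (inj₂ eq)) = inj₂ (inj₂ (trans eq (+-comm x y)))

    -- The triples 0, 1, 2 and 0, 1, 3 make δ at 2 and at 3 both equal to twice δ at 1, while the
    -- triple 0, 2, 3 makes the latter twice the former; so δ at 3 vanishes.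
    tail-bound : d 4 5 ≡ 0 → (∀ i → i < 4 → d i 4 ≢ 0) → ⊥
    tail-bound fixed distinct = δ≢0 3 ≤-refl (x≡y+x⇒y≡0 (δ 4 fixed 3)
      (trans (δ-doubles 4 fixed 0 1 0 (δ≢0 0 z<s) (δ≢0 3 ≤-refl)) (cong₂ _+_ δ₂≡δ₃ δ₂≡δ₃)))
      where
      δ≢0 : ∀ i → i < 4 → δ 4 fixed i ≢ 0
      δ≢0 = distinct
      δ₂≡δ₃ : δ 4 fixed 2 ≡ δ 4 fixed 3
      δ₂≡δ₃ = trans (δ-doubles 4 fixed 0 0 0 (δ≢0 0 z<s) (δ≢0 2 (s<s (s<s z<s))))
               (sym (δ-doubles 4 fixed 0 0 1 (δ≢0 0 z<s) (δ≢0 3 ≤-refl)))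

  -- The first repetition in an orbit

  least : ∀ {ℓ} {P : Pred ℕ ℓ} → Decidable P → ∀ {n} → P n → ∃[ m ] (P m × (∀ {i} → i < m → ¬ P i))
  least {P = P} P? {n} = <-rec (λ n → P n → ∃[ m ] (P m × (∀ {i} → i < m → ¬ P i))) search n
    where
    search : ∀ n → (∀ {i} → i < n → P i → _) → P n → _
    search n rec Pn with anyUpTo? P? n
    ... | yes (i , i<n , Pi) = rec i<n Pi
    ... | no ¬P              = n , Pn , λ {i} i<n Pi → ¬P (i , i<n , Pi)

  Repeats : (ℕ → ℕ → ℕ) → ℕ → Set
  Repeats d k = ∃[ j ] (j < k × d j k ≡ 0)

  repeats? : ∀ d → Decidable (Repeats d)
  repeats? d k = anyUpTo? (λ j → d j k ≟ 0) k

  -- By minimality of `k` the points below `k` are distinct: `j` of them form the tail, and the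
  -- other `k` - `j` form a cycle. Each residue class modulo the period contributes at most three
  -- tail points.
  first-repeat≤12 : ∀ {d} → IsDistance d → ∀ {n} → Repeats d n →
                    ∃[ k ] (k ≤ 12 × Repeats d k × (∀ {i j} → i < j → j < k → d i j ≢ 0))
  first-repeat≤12 {d} isDistance repeat with least (repeats? d) repeat
  ... | k , (j , j<k , djk≡0) , first = k , k≤12 , (j , j<k , djk≡0) , distinct
    where
    open Distance isDistance
    distinct : ∀ {i j} → i < j → j < k → d i j ≢ 0
    distinct i<j j<k eq = first j<k (_ , i<j , eq)

    n = k ℕ.∸ j

    j+n≡k : j + n ≡ k
    j+n≡k = m+[n∸m]≡n (<⇒≤ j<k)

    0<n : 0 < n
    0<n = m<n⇒0<n∸m j<k

    n≤3 : n ≤ 3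
    n≤3 = period≤3 (isDistance-subsequence isDistance j 1) 0<n record
      { returns = subst₂ (λ x y → d x y ≡ 0) (sym (+-identityʳ j))
                    (trans (sym j+n≡k) (cong (j +_) (sym (*-identityʳ n)))) djk≡0
      ; minimal = λ {m} 0<m m<n → subst₂ (λ x y → d x y ≢ 0) (sym (+-identityʳ j)) (cong (j +_) (sym (*-identityʳ m)))
                    (distinct (m<m+n j 0<m) (subst (j + m <_) j+n≡k (+-monoʳ-< j m<n)))
      }

    j≤3n : j ≤ 3 * n
    j≤3n with j ≤? 3 * n
    ... | yes p = p
    ... | no ¬p = ⊥-elim (Tail.tail-bound (isDistance-subsequence isDistance s n) fixed different)
      where
      open +-*-Solver
      -- Chosen so that s + 3n = j - 1 is the last point before the cycle and s + 4n = k - 1 the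
      -- last point of the cycle.
      s = j ℕ.∸ suc (3 * n)
      s+1+3n≡j : s + suc (3 * n) ≡ j
      s+1+3n≡j = m∸n+n≡m (≰⇒> ¬p)
      s+4n≡ : suc (s + 4 * n) ≡ k
      s+4n≡ = trans (solve 2 (λ s n → con 1 :+ (s :+ con 4 :* n) := s :+ (con 1 :+ con 3 :* n) :+ n) refl s n)
                (trans (cong (_+ n) s+1+3n≡j) j+n≡k)
      different : ∀ i → i < 4 → d (s + i * n) (s + 4 * n) ≢ 0
      different i i<4 = distinct (+-monoʳ-< s (*-monoˡ-< n {{>-nonZero 0<n}} i<4)) (≤-reflexive s+4n≡)
      -- s + 4n lies in the cycle, at distance n - 1 from its first point j.
      fixed : d (s + 4 * n) (s + 5 * n) ≡ 0
      fixed = subst₂ (λ x y → d x y ≡ 0) e₁ e₂ (shift-≡0 (n ℕ.∸ 1) djk≡0)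
        where
        n-1 = n ℕ.∸ 1
        n≡ : suc n-1 ≡ n
        n≡ = m+[n∸m]≡n 0<n
        e₁ : n-1 + j ≡ s + 4 * n
        e₁ = suc-injective (trans (cong (_+ j) n≡) (trans (+-comm n j) (trans j+n≡k (sym s+4n≡))))
        e₂ : n-1 + k ≡ s + 5 * n
        e₂ = trans (cong (n-1 +_) (sym j+n≡k)) (trans (sym (+-assoc n-1 j n)) (trans (cong (_+ n) e₁)
               (solve 2 (λ s n → s :+ con 4 :* n :+ n := s :+ con 5 :* n) refl s n)))

    k≤12 : k ≤ 12
    k≤12 = begin
      k           ≡⟨ j+n≡k ⟨
      j + n       ≤⟨ +-mono-≤ j≤3n ≤-refl ⟩
      3 * n + n   ≡⟨ +-comm (3 * n) n ⟩
      4 * n       ≤⟨ *-monoʳ-≤ 4 n≤3 ⟩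
      12          ∎
      where open ≤-Reasoning

open Dynamics

open import Data.Rational.Base using (ℚ; mkℚ; 0ℚ; 1ℚ; _+_; _*_; -_; 1/_; ↥_; ↧_; ↧ₙ_; ≢-nonZero)
open import Data.Rational.Literals using (fromℤ)
open import Data.Rational.Properties
  using (+-identityˡ; +-identityʳ; +-inverseʳ; +-*-commutativeRing; *-assoc; *-comm; *-distribʳ-+;
         *-identityˡ; *-identityʳ; *-inverseˡ; *-inverseʳ; *-zeroˡ; *-zeroʳ; neg-distribˡ-*;
         toℚᵘ-homo-+; toℚᵘ-homo-*; toℚᵘ-homo‿-; toℚᵘ-injective)
open import Data.Rational.Solver using (module +-*-Solver)

open CommutativeRing +-*-commutativeRing using (semiring; commutativeSemiring)
open import Algebra.Properties.Semiring.Sum semiring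
  using (sum; sum-cong-≗; *-distribˡ-sum; ∑-distrib-+)
open import Algebra.Properties.CommutativeSemiring.Exp commutativeSemiring
  using (_^_; ^-homo-*; ^-distrib-*)

-- Determinants

Matrix : ℕ → Set
Matrix n = Fin n → Fin n → ℚ

minor : ∀ {n} → Matrix (suc n) → Fin (suc n) → Matrix n
minor M k r c = M (suc r) (punchIn k c)

det-cong : ∀ {n} {M N : Matrix n} → (∀ r c → M r c ≡ N r c) → det M ≡ det N
det-cong {zero}  eq = refl
det-cong {suc n} {M} {N} eq = sum-cong-≗ λ k → cong ((- 1ℚ) ^ toℕ k *_)
  (cong₂ _*_ (eq zero k) (det-cong {M = minor M k} {minor N k} λ r c → eq (suc r) (punchIn k c)))

-- In the expansion along the first row, column `j` enters each term exactly once: through the entry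
-- when it is the deleted column, and through the minor otherwise, where induction applies.
det-linear : ∀ {n} (j : Fin n) t {A B C : Matrix n} →
             (∀ r c → c ≢ j → A r c ≡ B r c) → (∀ r c → c ≢ j → A r c ≡ C r c) →
             (∀ r → A r j ≡ B r j + t * C r j) → det A ≡ det B + t * det C
det-linear {suc n} j t {A} {B} {C} A≡B A≡C Aj = begin
  det A                                        ≡⟨ sum-cong-≗ term ⟩
  sum (λ k → b k + t * c k)                    ≡⟨ ∑-distrib-+ b (λ k → t * c k) ⟩
  sum b + sum (λ k → t * c k)                  ≡⟨ cong (sum b +_) (*-distribˡ-sum t c) ⟨
  det B + t * det C                            ∎
  where
  open ≡-Reasoning
  open +-*-Solver
  b c : Vector ℚ (suc n)
  b k = (- 1ℚ) ^ toℕ k * (B zero k * det (minor B k))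
  c k = (- 1ℚ) ^ toℕ k * (C zero k * det (minor C k))

  term : ∀ k → (- 1ℚ) ^ toℕ k * (A zero k * det (minor A k)) ≡ b k + t * c k
  term k with k Fin.≟ j
  ... | yes refl = begin
    s * (A zero k * det (minor A k))
      ≡⟨ cong (λ z → s * (z * det (minor A k))) (Aj zero) ⟩
    s * ((B zero k + t * C zero k) * det (minor A k))
      ≡⟨ solve 5 (λ s x t y m → s :* ((x :+ t :* y) :* m) := s :* (x :* m) :+ t :* (s :* (y :* m))) refl
           s (B zero k) t (C zero k) (det (minor A k)) ⟩
    s * (B zero k * det (minor A k)) + t * (s * (C zero k * det (minor A k)))
      ≡⟨ cong₂ (λ x y → s * (B zero k * x) + t * (s * (C zero k * y)))
           (det-cong {M = minor A k} {minor B k} λ r i → A≡B (suc r) (punchIn k i) (Fin.punchInᵢ≢i k i))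
           (det-cong {M = minor A k} {minor C k} λ r i → A≡C (suc r) (punchIn k i) (Fin.punchInᵢ≢i k i)) ⟩
    b k + t * c k ∎
    where s = (- 1ℚ) ^ toℕ k
  ... | no k≢j = begin
    s * (A zero k * det (minor A k))
      ≡⟨ cong (λ z → s * (A zero k * z)) (det-linear j′ t {minor A k} {minor B k} {minor C k}
           (λ r i i≢ → A≡B (suc r) (punchIn k i) (avoid i≢))
           (λ r i i≢ → A≡C (suc r) (punchIn k i) (avoid i≢))
           (λ r → subst (λ z → A (suc r) z ≡ B (suc r) z + t * C (suc r) z) (sym (Fin.punchIn-punchOut k≢j)) (Aj (suc r)))) ⟩
    s * (A zero k * (det (minor B k) + t * det (minor C k)))
      ≡⟨ solve 5 (λ s x t m m′ → s :* (x :* (m :+ t :* m′)) := s :* (x :* m) :+ t :* (s :* (x :* m′))) refl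
           s (A zero k) t (det (minor B k)) (det (minor C k)) ⟩
    s * (A zero k * det (minor B k)) + t * (s * (A zero k * det (minor C k)))
      ≡⟨ cong₂ (λ x y → s * (x * det (minor B k)) + t * (s * (y * det (minor C k)))) (A≡B zero k k≢j) (A≡C zero k k≢j) ⟩
    b k + t * c k ∎
    where
    s = (- 1ℚ) ^ toℕ k
    j′ = punchOut k≢j
    avoid : ∀ {i} → i ≢ j′ → punchIn k i ≢ j
    avoid i≢ eq = i≢ (Fin.punchIn-injective k _ _ (trans eq (sym (Fin.punchIn-punchOut k≢j))))

sum-adjacent : ∀ {n} (j : Fin n) (f : Vector ℚ (suc n)) →
               (∀ k → k ≢ inject₁ j → k ≢ suc j → f k ≡ 0ℚ) →
               f (inject₁ j) + f (suc j) ≡ 0ℚ → sum f ≡ 0ℚ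
sum-adjacent zero f others pair = begin
  f zero + (f (suc zero) + rest) ≡⟨ cong (λ z → f zero + (f (suc zero) + z)) (sum-zero (tail (tail f)) λ i → others (suc (suc i)) (λ ()) (λ ())) ⟩
  f zero + (f (suc zero) + 0ℚ)   ≡⟨ cong (f zero +_) (+-identityʳ (f (suc zero))) ⟩
  f zero + f (suc zero)          ≡⟨ pair ⟩
  0ℚ ∎
  where
  open ≡-Reasoning
  rest = sum (tail (tail f))
sum-adjacent (suc j) f others pair = trans (cong₂ _+_ (others zero (λ ()) (λ ()))
  (sum-adjacent j (tail f) (λ k p q → others (suc k) (p ∘ Fin.suc-injective) (q ∘ Fin.suc-injective)) pair))
  (+-identityˡ 0ℚ)

-- Adjacent columns stay adjacent when another column is deleted, so the induction in `det-adjacent`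
-- stays within adjacent pairs.
punchIn-adjacent : ∀ {n} (j : Fin (suc n)) k → k ≢ inject₁ j → k ≢ suc j →
  ∃[ i ] (punchIn k (inject₁ i) ≡ inject₁ j × punchIn k (suc i) ≡ suc j)
punchIn-adjacent zero zero k≢ _                          = contradiction refl k≢
punchIn-adjacent zero (suc zero) _ k≢                    = contradiction refl k≢
punchIn-adjacent {suc n} zero (suc (suc k)) _ _          = zero , refl , refl
punchIn-adjacent {suc n} (suc j) zero _ _                = j , refl , refl
punchIn-adjacent {suc n} (suc j) (suc k) p q =
  let i , eq , eq′ = punchIn-adjacent j k (p ∘ cong suc) (q ∘ cong suc) in
  suc i , cong suc eq , cong suc eq′

-- Deleting either of two neighbouring columns numbers the rest alike, except at the place where the
-- surviving neighbour stands.
punchIn-inject₁-suc : ∀ {n} (j c : Fin n) → punchIn (inject₁ j) c ≡ punchIn (suc j) c ⊎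
  (punchIn (inject₁ j) c ≡ suc j × punchIn (suc j) c ≡ inject₁ j)
punchIn-inject₁-suc zero    zero    = inj₂ (refl , refl)
punchIn-inject₁-suc zero    (suc c) = inj₁ refl
punchIn-inject₁-suc (suc j) zero    = inj₁ refl
punchIn-inject₁-suc (suc j) (suc c) with punchIn-inject₁-suc j c
... | inj₁ eq         = inj₁ (cong suc eq)
... | inj₂ (eq , eq′) = inj₂ (cong suc eq , cong suc eq′)

-- Adjacent columns are enough, since the sweeps below add a column only to its right neighbour. The
-- two terms deleting an equal column cancel by sign; the others vanish by induction.
det-adjacent : ∀ {n} (j : Fin n) (M : Matrix (suc n)) → (∀ r → M r (inject₁ j) ≡ M r (suc j)) → det M ≡ 0ℚ
det-adjacent {suc n} j M equal = sum-adjacent j (λ k → (- 1ℚ) ^ toℕ k * (M zero k * det (minor M k))) others pair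
  where
  open ≡-Reasoning
  open +-*-Solver
  others : ∀ k → k ≢ inject₁ j → k ≢ suc j → (- 1ℚ) ^ toℕ k * (M zero k * det (minor M k)) ≡ 0ℚ
  others k p q with i , eq , eq′ ← punchIn-adjacent j k p q = trans
    (cong (λ z → (- 1ℚ) ^ toℕ k * (M zero k * z)) (det-adjacent i (minor M k)
      λ r → trans (cong (M (suc r)) eq) (trans (equal (suc r)) (cong (M (suc r)) (sym eq′)))))
    (solve 2 (λ s x → s :* (x :* con 0ℚ) := con 0ℚ) refl ((- 1ℚ) ^ toℕ k) (M zero k))

  minors : ∀ r c → minor M (inject₁ j) r c ≡ minor M (suc j) r c
  minors r c with punchIn-inject₁-suc j c
  ... | inj₁ eq         = cong (M (suc r)) eq
  ... | inj₂ (eq , eq′) = trans (cong (M (suc r)) eq) (trans (sym (equal (suc r))) (cong (M (suc r)) (sym eq′)))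

  pair : (- 1ℚ) ^ toℕ (inject₁ j) * (M zero (inject₁ j) * det (minor M (inject₁ j)))
       + (- 1ℚ) ^ suc (toℕ j) * (M zero (suc j) * det (minor M (suc j))) ≡ 0ℚ
  pair = begin
    _ ≡⟨ cong₂ _+_ (cong₂ (λ e x → (- 1ℚ) ^ e * x) (Fin.toℕ-inject₁ j)
           (cong₂ _*_ (equal zero) (det-cong {M = minor M (inject₁ j)} {minor M (suc j)} minors))) refl ⟩
    s * (x * d) + (- 1ℚ * s) * (x * d)
      ≡⟨ solve 3 (λ s x d → s :* (x :* d) :+ (:- con 1ℚ :* s) :* (x :* d) := con 0ℚ) refl s x d ⟩
    0ℚ ∎
    where
    s = (- 1ℚ) ^ toℕ j
    x = M zero (suc j)
    d = det (minor M (suc j))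

-- The value at `t` of the polynomial with coefficients `f 0`, ..., `f k`, leading coefficient
-- first. Its recursion is the column operation to be performed.
horner : ℚ → (ℕ → ℚ) → ℕ → ℚ
horner t f zero    = f zero
horner t f (suc k) = f (suc k) + t * horner t f k

horner-suc : ∀ t f k → horner t f (suc k) ≡ f 0 * t ^ suc k + horner t (f ∘ suc) k
horner-suc t f zero = solve 3 (λ t a b → b :+ t :* a := a :* (t :* con 1ℚ) :+ b) refl t (f 0) (f 1)
  where open +-*-Solver
horner-suc t f (suc k) = trans (cong (λ z → f (suc (suc k)) + t * z) (horner-suc t f k))
  (solve 5 (λ t a b w h → b :+ t :* (a :* w :+ h) := a :* (t :* w) :+ (b :+ t :* h)) refl
    t (f 0) (f (suc (suc k))) (t ^ suc k) (horner t (f ∘ suc) k))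
  where open +-*-Solver

horner-coeff : ∀ {d} t (F : Form d) → horner t (coeff F) d ≡ eval F t 1ℚ
horner-coeff {zero}  t F = solve 1 (λ a → a := a :* (con 1ℚ :* con 1ℚ) :+ con 0ℚ) refl (F zero)
  where open +-*-Solver
horner-coeff {suc d} t F = begin
  horner t (coeff F) (suc d)                         ≡⟨ horner-suc t (coeff F) d ⟩
  F zero * t ^ suc d + horner t (coeff (tail F)) d   ≡⟨ cong (F zero * t ^ suc d +_) (trans (horner-coeff t (tail F)) (sym (*-identityˡ _))) ⟩
  F zero * t ^ suc d + 1ℚ * eval (tail F) t 1ℚ       ≡⟨ eval-suc F t 1ℚ ⟨
  eval F t 1ℚ                                        ∎
  where open ≡-Reasoning

coeff-beyond : ∀ {n} (v : Vector ℚ n) {k} → n ℕ.≤ k → coeff v k ≡ 0ℚ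
coeff-beyond {zero}  v n≤k             = refl
coeff-beyond {suc n} v (s≤s n≤k)       = coeff-beyond (tail v) n≤k

-- Every zero read after the last coefficient costs one multiplication by `t`.
horner-coeff-beyond : ∀ {d} t (F : Form d) e → horner t (coeff F) (e ℕ.+ d) ≡ t ^ e * eval F t 1ℚ
horner-coeff-beyond t F zero = trans (horner-coeff t F) (sym (*-identityˡ _))
horner-coeff-beyond {d} t F (suc e) = trans
  (cong₂ (λ x y → x + t * y) (coeff-beyond F (s≤s (ℕ.m≤n+m d e))) (horner-coeff-beyond t F e))
  (trans (+-identityˡ _) (sym (*-assoc t (t ^ e) (eval F t 1ℚ))))

horner-shift-suc : ∀ t i f k → horner t (shift (suc i) f) (suc k) ≡ horner t (shift i f) k
horner-shift-suc t i f zero    = trans (cong (shift i f 0 +_) (*-zeroʳ t)) (+-identityʳ (shift i f 0))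
horner-shift-suc t i f (suc k) = cong (λ z → shift i f (suc k) + t * z) (horner-shift-suc t i f k)

horner-shift : ∀ t i f k → horner t (shift i f) (i ℕ.+ k) ≡ horner t f k
horner-shift t zero    f k = refl
horner-shift t (suc i) f k = trans (horner-shift-suc t i f (i ℕ.+ k)) (horner-shift t i f k)

-- A row after the first `k` column operations: the columns up to `k` hold their final values and
-- the others are untouched.
sweep : ℚ → ℕ → (ℕ → ℚ) → ℕ → ℚ
sweep t k f c with c ℕ.≤? k
... | yes _ = horner t f c
... | no  _ = f c

sweep-≤ : ∀ t k f {c} → c ℕ.≤ k → sweep t k f c ≡ horner t f c
sweep-≤ t k f {c} c≤k with c ℕ.≤? k
... | yes _   = refl
... | no  c≰k = contradiction c≤k c≰k

sweep-> : ∀ t k f {c} → k ℕ.< c → sweep t k f c ≡ f c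
sweep-> t k f {c} k<c with c ℕ.≤? k
... | yes c≤k = contradiction c≤k (ℕ.<⇒≱ k<c)
... | no  _   = refl

sweep-suc : ∀ t k f {c} → c ≢ suc k → sweep t (suc k) f c ≡ sweep t k f c
sweep-suc t k f {c} c≢ with c ℕ.≤? k
... | yes c≤k = sweep-≤ t (suc k) f (ℕ.m≤n⇒m≤1+n c≤k)
... | no  c≰k = sweep-> t (suc k) f (ℕ.≤∧≢⇒< (ℕ.≰⇒> c≰k) (c≢ ∘ sym))

-- The new column `suc j` is the old one plus `t` times its finished left neighbour. `C` has that
-- neighbour copied into column `suc j`, so its determinant vanishes.
det-sweep-suc : ∀ {n} t (ρ : Fin (suc n) → ℕ → ℚ) (j : Fin n) →
  det (λ r (c : Fin (suc n)) → sweep t (suc (toℕ j)) (ρ r) (toℕ c)) ≡ det (λ r (c : Fin (suc n)) → sweep t (toℕ j) (ρ r) (toℕ c))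
det-sweep-suc {n} t ρ j = begin
  det A             ≡⟨ det-linear (suc j) t {A} {B} {C} A≡B A≡C column ⟩
  det B + t * det C ≡⟨ cong (λ z → det B + t * z) (det-adjacent j C adjacent) ⟩
  det B + t * 0ℚ    ≡⟨ cong (det B +_) (*-zeroʳ t) ⟩
  det B + 0ℚ        ≡⟨ +-identityʳ (det B) ⟩
  det B             ∎
  where
  open ≡-Reasoning
  A B C : Matrix (suc n)
  A r c = sweep t (suc (toℕ j)) (ρ r) (toℕ c)
  B r c = sweep t (toℕ j) (ρ r) (toℕ c)
  C r c with c Fin.≟ suc j
  ... | yes _ = horner t (ρ r) (toℕ j)
  ... | no  _ = B r c

  C-diagonal : ∀ r → C r (suc j) ≡ horner t (ρ r) (toℕ j)
  C-diagonal r with suc j Fin.≟ suc j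
  ... | yes _  = refl
  ... | no  ¬p = contradiction refl ¬p

  C-other : ∀ r c → c ≢ suc j → C r c ≡ B r c
  C-other r c c≢ with c Fin.≟ suc j
  ... | yes p = contradiction p c≢
  ... | no  _ = refl

  A≡B : ∀ r c → c ≢ suc j → A r c ≡ B r c
  A≡B r c c≢ = sweep-suc t (toℕ j) (ρ r) (c≢ ∘ Fin.toℕ-injective)

  A≡C : ∀ r c → c ≢ suc j → A r c ≡ C r c
  A≡C r c c≢ = trans (A≡B r c c≢) (sym (C-other r c c≢))

  column : ∀ r → A r (suc j) ≡ B r (suc j) + t * C r (suc j)
  column r = trans (sweep-≤ t (suc (toℕ j)) (ρ r) ℕ.≤-refl)
    (cong₂ (λ x y → x + t * y) (sym (sweep-> t (toℕ j) (ρ r) ℕ.≤-refl)) (sym (C-diagonal r)))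

  adjacent : ∀ r → C r (inject₁ j) ≡ C r (suc j)
  adjacent r = trans (C-other r (inject₁ j) (λ eq → ℕ.1+n≢n (trans (sym (cong toℕ eq)) (Fin.toℕ-inject₁ j))))
    (trans (trans (cong (sweep t (toℕ j) (ρ r)) (Fin.toℕ-inject₁ j)) (sweep-≤ t (toℕ j) (ρ r) ℕ.≤-refl)) (sym (C-diagonal r)))

-- Adding t times each column to the next one, from left to right, preserves
-- the determinant.
det-horner : ∀ {n} t (ρ : Fin (suc n) → ℕ → ℚ) →
  det (λ r (c : Fin (suc n)) → horner t (ρ r) (toℕ c)) ≡ det (λ r (c : Fin (suc n)) → ρ r (toℕ c))
det-horner {n} t ρ = trans
  (det-cong {M = λ r (c : Fin (suc n)) → horner t (ρ r) (toℕ c)} λ r c → sym (sweep-≤ t n (ρ r) (s≤s⁻¹ (Fin.toℕ<n c))))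
  (sweeps n ℕ.≤-refl)
  where
  sweep-0 : ∀ f c → sweep t 0 f c ≡ f c
  sweep-0 f zero    = refl
  sweep-0 f (suc c) = sweep-> t 0 f (s≤s z≤n)

  sweeps : ∀ k → k ℕ.≤ n → det (λ r (c : Fin (suc n)) → sweep t k (ρ r) (toℕ c)) ≡ det (λ r (c : Fin (suc n)) → ρ r (toℕ c))
  sweeps zero    _   = det-cong {M = λ r (c : Fin (suc n)) → sweep t 0 (ρ r) (toℕ c)} λ r c → sweep-0 (ρ r) (toℕ c)
  sweeps (suc k) k<n = trans
    (subst (λ k → det (λ r (c : Fin (suc n)) → sweep t (suc k) (ρ r) (toℕ c)) ≡ det (λ r (c : Fin (suc n)) → sweep t k (ρ r) (toℕ c)))
      (Fin.toℕ-fromℕ< k<n) (det-sweep-suc t ρ (fromℕ< k<n)))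
    (sweeps k (ℕ.<⇒≤ k<n))

-- Subrings and ideals

-- A predicate on ℚ, so that `det`, `eval` and `Res` remain the rational ones and only membership is
-- tracked.
record IsSubring (R : ℚ → Set) : Set where
  field
    1∈  : R 1ℚ
    -1∈ : R (- 1ℚ)
    +∈  : ∀ {x y} → R x → R y → R (x + y)
    *∈  : ∀ {x y} → R x → R y → R (x * y)

  0∈ : R 0ℚ
  0∈ = subst R (+-inverseʳ 1ℚ) (+∈ 1∈ -1∈)

  -∈ : ∀ {x} → R x → R (- x)
  -∈ {x} x∈ = subst R (trans (sym (neg-distribˡ-* 1ℚ x)) (cong -_ (*-identityˡ x))) (*∈ -1∈ x∈)

  ^∈ : ∀ {x} → R x → ∀ n → R (x ^ n)
  ^∈ x∈ zero    = 1∈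
  ^∈ x∈ (suc n) = *∈ x∈ (^∈ x∈ n)

record IsIdeal (R I : ℚ → Set) : Set where
  field
    zero∈     : I 0ℚ
    sum∈      : ∀ {x y} → I x → I y → I (x + y)
    multiple∈ : ∀ {r x} → R r → I x → I (r * x)

  multiple∈ʳ : ∀ {r x} → R r → I x → I (x * r)
  multiple∈ʳ {r} {x} r∈ x∈ = subst I (*-comm r x) (multiple∈ r∈ x∈)

  ∑∈ : ∀ {n} (f : Vector ℚ n) → (∀ i → I (f i)) → I (sum f)
  ∑∈ {zero}  f f∈ = zero∈
  ∑∈ {suc n} f f∈ = sum∈ (f∈ zero) (∑∈ (tail f) (f∈ ∘ suc))

module Subring {R : ℚ → Set} (isSubring : IsSubring R) where
  open IsSubring isSubring

  subring-isIdeal : IsIdeal R R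
  subring-isIdeal = record { zero∈ = 0∈ ; sum∈ = +∈ ; multiple∈ = *∈ }

  det∈ : ∀ {n} (M : Matrix n) → (∀ r c → R (M r c)) → R (det M)
  det∈ {zero}  M M∈ = 1∈
  det∈ {suc n} M M∈ = IsIdeal.∑∈ subring-isIdeal (λ k → (- 1ℚ) ^ toℕ k * (M zero k * det (minor M k)))
    λ k → *∈ (^∈ -1∈ (toℕ k)) (*∈ (M∈ zero k) (det∈ (minor M k) λ r c → M∈ (suc r) (punchIn k c)))

  eval∈ : ∀ {d} (F : Form d) → (∀ i → R (F i)) → ∀ {x y} → R x → R y → R (eval F x y)
  eval∈ {d} F F∈ {x} {y} x∈ y∈ = IsIdeal.∑∈ subring-isIdeal (λ i → F i * (x ^ (d ℕ.∸ toℕ i) * y ^ toℕ i))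
    λ i → *∈ (F∈ i) (*∈ (^∈ x∈ (d ℕ.∸ toℕ i)) (^∈ y∈ (toℕ i)))

  coeff∈ : ∀ {n} (v : Vector ℚ n) → (∀ i → R (v i)) → ∀ k → R (coeff v k)
  coeff∈ {zero}  v v∈ k       = 0∈
  coeff∈ {suc n} v v∈ zero    = v∈ zero
  coeff∈ {suc n} v v∈ (suc k) = coeff∈ (tail v) (v∈ ∘ suc) k

  shift∈ : ∀ i {f} → (∀ k → R (f k)) → ∀ k → R (shift i f k)
  shift∈ zero    f∈ k       = f∈ k
  shift∈ (suc i) f∈ zero    = 0∈
  shift∈ (suc i) f∈ (suc k) = shift∈ i f∈ k

  horner∈ : ∀ {t} → R t → ∀ {f} → (∀ k → R (f k)) → ∀ k → R (horner t f k)
  horner∈ t∈ f∈ zero    = f∈ zero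
  horner∈ t∈ f∈ (suc k) = +∈ (f∈ (suc k)) (*∈ t∈ (horner∈ t∈ f∈ k))

  module Ideal {I : ℚ → Set} (I-isIdeal : IsIdeal R I) where
    open IsIdeal I-isIdeal

    -- Each term of the expansion contains the column either in its entry or in its minor.
    det-column∈ : ∀ {n} (M : Matrix n) → (∀ r c → R (M r c)) → ∀ j → (∀ r → I (M r j)) → I (det M)
    det-column∈ {suc n} M M∈ j col∈ = ∑∈ (λ k → (- 1ℚ) ^ toℕ k * (M zero k * det (minor M k))) term
      where
      minor∈ : ∀ k r c → R (minor M k r c)
      minor∈ k r c = M∈ (suc r) (punchIn k c)
      term : ∀ k → I ((- 1ℚ) ^ toℕ k * (M zero k * det (minor M k)))
      term k with k Fin.≟ j
      ... | yes refl = multiple∈ (^∈ -1∈ (toℕ k)) (multiple∈ʳ (det∈ (minor M k) (minor∈ k)) (col∈ zero))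
      ... | no k≢j   = multiple∈ (^∈ -1∈ (toℕ k)) (multiple∈ (M∈ zero k)
        (det-column∈ (minor M k) (minor∈ k) (punchOut k≢j)
          λ r → subst (λ c → I (M (suc r) c)) (sym (Fin.punchIn-punchOut k≢j)) (col∈ (suc r))))

    module _ {d} (F G : Form (suc d)) (F∈ : ∀ i → R (F i)) (G∈ : ∀ i → R (G i)) where

      -- Sylvester rows continued to all natural column indices, the form that `horner` acts on.
      row : Fin (suc d ℕ.+ suc d) → ℕ → ℚ
      row r k with splitAt (suc d) r
      ... | inj₁ i = shift (toℕ i) (coeff F) k
      ... | inj₂ i = shift (toℕ i) (coeff G) k

      row∈ : ∀ r k → R (row r k)
      row∈ r k with splitAt (suc d) r
      ... | inj₁ i = shift∈ (toℕ i) (coeff∈ F F∈) k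
      ... | inj₂ i = shift∈ (toℕ i) (coeff∈ G G∈) k

      sylvester≡row : ∀ r c → sylvester F G r c ≡ row r (toℕ c)
      sylvester≡row r c with splitAt (suc d) r
      ... | inj₁ i = refl
      ... | inj₂ i = refl

      -- The common zero at infinity, [1 : 0]: the first Sylvester column holds only the two leading
      -- coefficients and zeros.
      Res-leading∈ : I (F zero) → I (G zero) → I (Res F G)
      Res-leading∈ F₀∈ G₀∈ = det-column∈ (sylvester F G)
        (λ r c → subst R (sym (sylvester≡row r c)) (row∈ r (toℕ c))) zero
        (λ r → subst I (sym (sylvester≡row r zero)) (column r))
        where
        shifted : ∀ i {f} → I (f 0) → I (shift i f 0)
        shifted zero    f₀∈ = f₀∈
        shifted (suc i) f₀∈ = zero∈
        column : ∀ r → I (row r 0)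
        column r with splitAt (suc d) r
        ... | inj₁ i = shifted (toℕ i) F₀∈
        ... | inj₂ i = shifted (toℕ i) G₀∈

      -- After the column operations of det-horner the last column consists of
      -- multiples of F(t,1) and G(t,1).
      Res-root∈ : ∀ {t} → R t → I (eval F t 1ℚ) → I (eval G t 1ℚ) → I (Res F G)
      Res-root∈ {t} t∈ Ft∈ Gt∈ = subst I
        (trans (det-horner t row) (sym (det-cong {M = sylvester F G} sylvester≡row)))
        (det-column∈ (λ r c → horner t (row r) (toℕ c)) (λ r c → horner∈ t∈ (row∈ r) (toℕ c))
          (fromℕ (d ℕ.+ suc d)) λ r → subst (λ k → I (horner t (row r) k)) (sym (Fin.toℕ-fromℕ (d ℕ.+ suc d))) (column r))
        where
        -- The last column has index 2d + 1 = i + (d - i) + (d + 1): the `i` leading zeros drop out,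
        -- and the d - i trailing ones leave the factor t^(d - i).
        shifted : ∀ (H : Form (suc d)) i → i ℕ.≤ d → I (eval H t 1ℚ) → I (horner t (shift i (coeff H)) (d ℕ.+ suc d))
        shifted H i i≤d Ht∈ = subst I
          (sym (trans (cong (horner t (shift i (coeff H))) index)
            (trans (horner-shift t i (coeff H) (d ℕ.∸ i ℕ.+ suc d)) (horner-coeff-beyond t H (d ℕ.∸ i)))))
          (multiple∈ (^∈ t∈ (d ℕ.∸ i)) Ht∈)
          where
          index : d ℕ.+ suc d ≡ i ℕ.+ (d ℕ.∸ i ℕ.+ suc d)
          index = trans (cong (ℕ._+ suc d) (sym (ℕ.m+[n∸m]≡n i≤d))) (ℕ.+-assoc i (d ℕ.∸ i) (suc d))
        column : ∀ r → I (horner t (row r) (d ℕ.+ suc d))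
        column r with splitAt (suc d) r
        ... | inj₁ i = shifted F (toℕ i) (s≤s⁻¹ (Fin.toℕ<n i)) Ft∈
        ... | inj₂ i = shifted G (toℕ i) (s≤s⁻¹ (Fin.toℕ<n i)) Gt∈

-- Values of products of forms

module _ (x y : ℚ) where
  open ≡-Reasoning
  open +-*-Solver

  -- A product `F ⋆ A` is a bare coefficient sequence, so its degree has to be supplied separately.
  evalℕ : ℕ → (ℕ → ℚ) → ℚ
  evalℕ zero    c = c 0
  evalℕ (suc n) c = c 0 * x ^ suc n + y * evalℕ n (c ∘ suc)

  evalℕ-cong : ∀ n {b c} → (∀ k → b k ≡ c k) → evalℕ n b ≡ evalℕ n c
  evalℕ-cong zero    eq = eq 0
  evalℕ-cong (suc n) eq = cong₂ (λ u v → u * x ^ suc n + y * v) (eq 0) (evalℕ-cong n (eq ∘ suc))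

  evalℕ-zero : ∀ n {c} → (∀ k → c k ≡ 0ℚ) → evalℕ n c ≡ 0ℚ
  evalℕ-zero zero    eq = eq 0
  evalℕ-zero (suc n) eq = trans (cong₂ (λ u v → u * x ^ suc n + y * v) (eq 0) (evalℕ-zero n (eq ∘ suc)))
    (solve 2 (λ w y → con 0ℚ :* w :+ y :* con 0ℚ := con 0ℚ) refl (x ^ suc n) y)

  evalℕ-linear : ∀ n a b c → evalℕ n (λ k → a * b k + c k) ≡ a * evalℕ n b + evalℕ n c
  evalℕ-linear zero    a b c = refl
  evalℕ-linear (suc n) a b c = trans (cong (λ z → (a * b 0 + c 0) * x ^ suc n + y * z) (evalℕ-linear n a (b ∘ suc) (c ∘ suc)))
    (solve 7 (λ a b c w y u v → (a :* b :+ c) :* w :+ y :* (a :* u :+ v) := a :* (b :* w :+ y :* u) :+ (c :* w :+ y :* v))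
      refl a (b 0) (c 0) (x ^ suc n) y (evalℕ n (b ∘ suc)) (evalℕ n (c ∘ suc)))

  evalℕ-coeff : ∀ {d} (F : Form d) → evalℕ d (coeff F) ≡ eval F x y
  evalℕ-coeff {zero}  F = solve 1 (λ a → a := a :* (con 1ℚ :* con 1ℚ) :+ con 0ℚ) refl (F zero)
  evalℕ-coeff {suc d} F = trans (cong (λ z → F zero * x ^ suc d + y * z) (evalℕ-coeff (tail F))) (sym (eval-suc F x y))

  evalℕ-pad : ∀ n m {c} → (∀ k → n ℕ.< k → c k ≡ 0ℚ) → evalℕ (n ℕ.+ m) c ≡ x ^ m * evalℕ n c
  evalℕ-pad zero zero    beyond = sym (*-identityˡ _)
  evalℕ-pad zero (suc m) {c} beyond = trans (cong (λ z → c 0 * x ^ suc m + y * z) (evalℕ-zero m (λ k → beyond (suc k) (s≤s z≤n))))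
    (solve 3 (λ a w y → a :* w :+ y :* con 0ℚ := w :* a) refl (c 0) (x ^ suc m) y)
  evalℕ-pad (suc n) m {c} beyond = trans
    (cong₂ (λ u v → c 0 * (x * u) + y * v) (^-homo-* x n m) (evalℕ-pad n m {c ∘ suc} (λ k n<k → beyond (suc k) (s≤s n<k))))
    (solve 6 (λ a x u w y e → a :* (x :* (u :* w)) :+ y :* (w :* e) := w :* (a :* (x :* u) :+ y :* e)) refl
      (c 0) x (x ^ n) (x ^ m) y (evalℕ n (c ∘ suc)))

  evalℕ-coeff-pad : ∀ m {e} (A : Form e) → evalℕ (m ℕ.+ e) (coeff A) ≡ x ^ m * eval A x y
  evalℕ-coeff-pad m {e} A = trans (cong (λ n → evalℕ n (coeff A)) (ℕ.+-comm m e))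
    (trans (evalℕ-pad e m (λ k → coeff-beyond A)) (cong (x ^ m *_) (evalℕ-coeff A)))

  -- Induction on the leading coefficient of `F`: by computation (F ⋆ A) (k + 1) is `F zero` times a
  -- coefficient of `A` plus the product of `tail F` and `A` at k.
  eval-⋆ : ∀ {d e} (F : Form d) (A : Form e) → evalℕ (d ℕ.+ e) (F ⋆ A) ≡ eval F x y * eval A x y
  eval-⋆ {zero} {e} F A = begin
    evalℕ e (F ⋆ A)                              ≡⟨ evalℕ-cong e constant ⟩
    evalℕ e (λ k → F zero * coeff A k + 0ℚ)      ≡⟨ evalℕ-linear e (F zero) (coeff A) (λ _ → 0ℚ) ⟩
    F zero * evalℕ e (coeff A) + evalℕ e (λ _ → 0ℚ) ≡⟨ cong₂ (λ u v → F zero * u + v) (evalℕ-coeff A) (evalℕ-zero e (λ _ → refl)) ⟩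
    F zero * eval A x y + 0ℚ                     ≡⟨ solve 2 (λ a e → a :* e :+ con 0ℚ := (a :* (con 1ℚ :* con 1ℚ) :+ con 0ℚ) :* e) refl (F zero) (eval A x y) ⟩
    eval F x y * eval A x y                      ∎
    where
    constant : ∀ k → (F ⋆ A) k ≡ F zero * coeff A k + 0ℚ
    constant k = cong (F zero * coeff A k +_)
      (sum-zero rest λ j → *-zeroˡ (coeff A (k ℕ.∸ suc (toℕ j))))
      where
      rest : Vector ℚ k
      rest j = 0ℚ * coeff A (k ℕ.∸ suc (toℕ j))
  eval-⋆ {suc d} {e} F A = begin
    (F zero * A zero + 0ℚ) * x ^ suc n + y * evalℕ n (λ k → F zero * coeff A (suc k) + (tail F ⋆ A) k)
      ≡⟨ cong (λ z → (F zero * A zero + 0ℚ) * x ^ suc n + y * z)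
           (trans (evalℕ-linear n (F zero) (coeff A ∘ suc) (tail F ⋆ A))
             (cong (F zero * evalℕ n (coeff A ∘ suc) +_) (eval-⋆ (tail F) A))) ⟩
    (F zero * A zero + 0ℚ) * x ^ suc n + y * (F zero * evalℕ n (coeff A ∘ suc) + eval (tail F) x y * eval A x y)
      ≡⟨ solve 7 (λ f a w y u t v → (f :* a :+ con 0ℚ) :* w :+ y :* (f :* u :+ t :* v) := f :* (a :* w :+ y :* u) :+ y :* (t :* v)) refl
           (F zero) (A zero) (x ^ suc n) y (evalℕ n (coeff A ∘ suc)) (eval (tail F) x y) (eval A x y) ⟩
    F zero * evalℕ (suc n) (coeff A) + y * (eval (tail F) x y * eval A x y)
      ≡⟨ cong (λ z → F zero * z + y * (eval (tail F) x y * eval A x y)) (evalℕ-coeff-pad (suc d) A) ⟩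
    F zero * (x ^ suc d * eval A x y) + y * (eval (tail F) x y * eval A x y)
      ≡⟨ solve 5 (λ f w v y t → f :* (w :* v) :+ y :* (t :* v) := (f :* w :+ y :* t) :* v) refl
           (F zero) (x ^ suc d) (eval A x y) y (eval (tail F) x y) ⟩
    (F zero * x ^ suc d + y * eval (tail F) x y) * eval A x y
      ≡⟨ cong (_* eval A x y) (eval-suc F x y) ⟨
    eval F x y * eval A x y ∎
    where n = d ℕ.+ e

  ≈ᴱ⇒proportional : ∀ {φ ψ} → φ ≈ᴱ ψ → let open Endomorphism in
    eval (F φ) x y * eval (G ψ) x y ≡ eval (G φ) x y * eval (F ψ) x y
  ≈ᴱ⇒proportional {φ} {ψ} φ≈ψ = trans (sym (eval-⋆ (F φ) (G ψ)))
    (trans (evalℕ-cong (degree φ ℕ.+ degree ψ) φ≈ψ) (eval-⋆ (G φ) (F ψ)))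
    where open Endomorphism

-- Congruences modulo an ideal

module Congruence {R : ℚ → Set} (isSubring : IsSubring R) {I : ℚ → Set} (I-isIdeal : IsIdeal R I) where
  open IsSubring isSubring
  open IsIdeal I-isIdeal
  open Subring isSubring
  open +-*-Solver

  infix 4 _≋_
  _≋_ : ℚ → ℚ → Set
  x ≋ y = I (x + - y)

  +-cong-≋ : ∀ {x x′ y y′} → x ≋ x′ → y ≋ y′ → x + y ≋ x′ + y′
  +-cong-≋ {x} {x′} {y} {y′} p q = subst I
    (solve 4 (λ x x′ y y′ → (x :- x′) :+ (y :- y′) := (x :+ y) :- (x′ :+ y′)) refl x x′ y y′) (sum∈ p q)

  *-cong-≋ : ∀ {x x′ y y′} → R x → R y′ → x ≋ x′ → y ≋ y′ → x * y ≋ x′ * y′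
  *-cong-≋ {x} {x′} {y} {y′} x∈ y′∈ p q = subst I
    (solve 4 (λ x x′ y y′ → x :* (y :- y′) :+ y′ :* (x :- x′) := x :* y :- x′ :* y′) refl x x′ y y′)
    (sum∈ (multiple∈ x∈ q) (multiple∈ y′∈ p))

  refl-≋ : ∀ {x} → x ≋ x
  refl-≋ {x} = subst I (sym (+-inverseʳ x)) zero∈

  ^-cong-≋ : ∀ {x x′} → R x → R x′ → x ≋ x′ → ∀ n → x ^ n ≋ x′ ^ n
  ^-cong-≋ x∈ x′∈ p zero    = refl-≋ {1ℚ}
  ^-cong-≋ {x} {x′} x∈ x′∈ p (suc n) = *-cong-≋ {x} {x′} {x ^ n} {x′ ^ n} x∈ (^∈ x′∈ n) p (^-cong-≋ x∈ x′∈ p n)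

  eval-cong-≋ : ∀ {d} (F : Form d) → (∀ i → R (F i)) → ∀ {x x′ y y′} → R x → R x′ → R y → R y′ →
                x ≋ x′ → y ≋ y′ → eval F x y ≋ eval F x′ y′
  eval-cong-≋ {zero}  F F∈ {x} {x′} {y} {y′} x∈ x′∈ y∈ y′∈ p q = refl-≋ {eval F x y}
  eval-cong-≋ {suc d} F F∈ {x} {x′} {y} {y′} x∈ x′∈ y∈ y′∈ p q = subst₂ _≋_ (sym (eval-suc F x y)) (sym (eval-suc F x′ y′))
    (+-cong-≋ {F zero * x ^ suc d} {F zero * x′ ^ suc d} {y * eval (tail F) x y} {y′ * eval (tail F) x′ y′}
      (*-cong-≋ {F zero} {F zero} {x ^ suc d} {x′ ^ suc d} (F∈ zero) (^∈ x′∈ (suc d)) (refl-≋ {F zero}) (^-cong-≋ x∈ x′∈ p (suc d)))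
      (*-cong-≋ {y} {y′} {eval (tail F) x y} {eval (tail F) x′ y′} y∈ (eval∈ (tail F) (F∈ ∘ suc) x′∈ y′∈) q
        (eval-cong-≋ (tail F) (F∈ ∘ suc) x∈ x′∈ y∈ y′∈ p q)))

open import Data.Integer.Base as ℤ using (ℤ; +_; -[1+_]; _⊖_; ∣_∣; 0ℤ; 1ℤ)
import Data.Integer.Divisibility.Signed as ℤ
import Data.Integer.Properties as ℤ
import Data.Integer.Solver as ℤ-Solver

-- Primitive integer vectors

∣⊖∣-balanced : ∀ m n → Balanced m (∣ m ⊖ n ∣) n
∣⊖∣-balanced m n with ℕ.≤-total m n
... | inj₁ m≤n rewrite ℤ.∣⊖∣-≤ m≤n = inj₂ (inj₂ (sym (ℕ.m+[n∸m]≡n m≤n)))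
... | inj₂ n≤m rewrite ℤ.∣m⊖n∣≡∣n⊖m∣ m n | ℤ.∣⊖∣-≤ n≤m = inj₁ (sym (ℕ.m∸n+n≡m n≤m))

-- Equal signs add the absolute values; opposite signs subtract them.
∣+∣-balanced : ∀ x z → Balanced (∣ x ∣) (∣ x ℤ.+ z ∣) (∣ z ∣)
∣+∣-balanced (+ m)    (+ n)    = inj₂ (inj₁ refl)
∣+∣-balanced (+ m)    -[1+ n ] = ∣⊖∣-balanced m (suc n)
∣+∣-balanced -[1+ m ] (+ n)    = Balanced-cong refl (ℤ.∣m⊖n∣≡∣n⊖m∣ (suc m) n) refl (∣⊖∣-balanced (suc m) n)
∣+∣-balanced -[1+ m ] -[1+ n ] = inj₂ (inj₁ (cong suc (sym (ℕ.+-suc m n))))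

-- Coprimality is kept as an explicit Bézout identity, an equation that can be carried unchanged
-- into ℤ₍ₚ₎.
record Primitive : Set where
  field
    a b u v : ℤ
    bézout  : u ℤ.* a ℤ.+ v ℤ.* b ≡ 1ℤ

module _ where
  open Primitive

  cross : Primitive → Primitive → ℤ
  cross P Q = a P ℤ.* b Q ℤ.- b P ℤ.* a Q

  separation : Primitive → Primitive → ℕ
  separation P Q = ∣ cross P Q ∣

  module _ where
    open ℤ-Solver.+-*-Solver

    cross-self : ∀ P → cross P P ≡ 0ℤ
    cross-self P = solve 2 (λ a b → a :* b :- b :* a := con 0ℤ) refl (a P) (b P)

    cross-swap : ∀ P Q → cross P Q ≡ ℤ.- cross Q P
    cross-swap P Q = solve 4 (λ a b c d → a :* d :- b :* c := :- (c :* b :- d :* a)) refl (a P) (b P) (a Q) (b Q)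

    -- The ultrametric inequality as an equation. It becomes a polynomial identity once the left
    -- side is multiplied by the Bézout sum of `Q`.
    cross-combination : ∀ P Q R → cross P R ≡
      (u Q ℤ.* a P ℤ.+ v Q ℤ.* b P) ℤ.* cross Q R ℤ.+ (u Q ℤ.* a R ℤ.+ v Q ℤ.* b R) ℤ.* cross P Q
    cross-combination P Q R = trans
      (trans (sym (ℤ.*-identityˡ (cross P R))) (cong (ℤ._* cross P R) (sym (bézout Q))))
      (solve 8 (λ a b c d e f u v →
        (u :* c :+ v :* d) :* (a :* f :- b :* e) :=
        (u :* a :+ v :* b) :* (c :* f :- d :* e) :+ (u :* e :+ v :* f) :* (a :* d :- b :* c)) refl
        (a P) (b P) (a Q) (b Q) (a R) (b R) (u Q) (v Q))

    cross-plücker : ∀ P Q R S → cross P R ℤ.* cross Q S ≡ cross P Q ℤ.* cross R S ℤ.+ cross P S ℤ.* cross Q R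
    cross-plücker P Q R S = solve 8 (λ a b c d e f g h →
        (a :* f :- b :* e) :* (c :* h :- d :* g) :=
        (a :* d :- b :* c) :* (e :* h :- f :* g) :+ (a :* h :- b :* g) :* (c :* f :- d :* e)) refl
        (a P) (b P) (a Q) (b Q) (a R) (b R) (a S) (b S)

  separation-isDistance : ∀ (V : ℕ → Primitive) →
    (∀ i j → separation (V i) (V j) ℕ.∣ separation (V (suc i)) (V (suc j))) →
    IsDistance (λ i j → separation (V i) (V j))
  separation-isDistance V step = record
    { diagonal = λ i → cong ∣_∣ (cross-self (V i))
    ; symmetry = λ i j → trans (cong ∣_∣ (cross-swap (V i) (V j))) (ℤ.∣-i∣≡∣i∣ (cross (V j) (V i)))
    ; ultra    = λ {g} i j k g∣ij g∣jk → ℤ.∣⇒∣ᵤ {+ g} (subst (+ g ℤ.∣_) (sym (cross-combination (V i) (V j) (V k)))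
        (ℤ.∣m∣n⇒∣m+n (ℤ.∣n⇒∣m*n (u (V j) ℤ.* a (V i) ℤ.+ v (V j) ℤ.* b (V i)) (ℤ.∣ᵤ⇒∣ {+ g} g∣jk))
                     (ℤ.∣n⇒∣m*n (u (V j) ℤ.* a (V k) ℤ.+ v (V j) ℤ.* b (V k)) (ℤ.∣ᵤ⇒∣ {+ g} g∣ij))))
    ; plücker  = λ i j k l → Balanced-cong
        (ℤ.abs-* (cross (V i) (V j)) (cross (V k) (V l)))
        (trans (cong ∣_∣ (sym (cross-plücker (V i) (V j) (V k) (V l)))) (ℤ.abs-* (cross (V i) (V k)) (cross (V j) (V l))))
        (ℤ.abs-* (cross (V i) (V l)) (cross (V j) (V k)))
        (∣+∣-balanced (cross (V i) (V j) ℤ.* cross (V k) (V l)) (cross (V i) (V l) ℤ.* cross (V j) (V k)))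
    ; step     = step
    }

  ∣∣-multiple : ∀ x → ∃[ s ] (+ ∣ x ∣ ≡ s ℤ.* x)
  ∣∣-multiple x with ℤ.+∣i∣≡i⊎+∣i∣≡-i x
  ... | inj₁ eq = 1ℤ , trans eq (sym (ℤ.*-identityˡ x))
  ... | inj₂ eq = ℤ.- 1ℤ , trans eq (sym (ℤ.-1*i≡-i x))

  bézout-signed : ∀ x y → ∃[ s ] ∃[ t ] (s ℤ.* x ℤ.+ t ℤ.* y ≡ + gcd (∣ x ∣) (∣ y ∣))
  bézout-signed x y = combine (Bézout.identity (gcd-GCD (∣ x ∣) (∣ y ∣)))
    where
    open ℤ-Solver.+-*-Solver
    g = gcd (∣ x ∣) (∣ y ∣)
    σ = proj₁ (∣∣-multiple x)
    τ = proj₁ (∣∣-multiple y)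

    lift : ∀ p q m n → g ℕ.+ q ℕ.* n ≡ p ℕ.* m → + g ≡ + p ℤ.* + m ℤ.- + q ℤ.* + n
    lift p q m n eq = begin
      + g                                           ≡⟨ solve 2 (λ g r → g := g :+ r :- r) refl (+ g) (+ q ℤ.* + n) ⟩
      + g ℤ.+ + q ℤ.* + n ℤ.- + q ℤ.* + n           ≡⟨ cong (λ w → + g ℤ.+ w ℤ.- + q ℤ.* + n) (ℤ.pos-* q n) ⟨
      + (g ℕ.+ q ℕ.* n) ℤ.- + q ℤ.* + n             ≡⟨ cong (λ w → + w ℤ.- + q ℤ.* + n) eq ⟩
      + (p ℕ.* m) ℤ.- + q ℤ.* + n                   ≡⟨ cong (ℤ._- + q ℤ.* + n) (ℤ.pos-* p m) ⟩
      + p ℤ.* + m ℤ.- + q ℤ.* + n                   ∎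
      where open ≡-Reasoning

    combine : Bézout.Identity g (∣ x ∣) (∣ y ∣) → ∃[ s ] ∃[ t ] (s ℤ.* x ℤ.+ t ℤ.* y ≡ + g)
    combine (Bézout.+- p q eq) = + p ℤ.* σ , ℤ.- (+ q ℤ.* τ) , sym (trans
      (trans (lift p q (∣ x ∣) (∣ y ∣) eq)
        (cong₂ (λ i j → + p ℤ.* i ℤ.- + q ℤ.* j) (proj₂ (∣∣-multiple x)) (proj₂ (∣∣-multiple y))))
      (solve 6 (λ p σ x q τ y → p :* (σ :* x) :- q :* (τ :* y) := p :* σ :* x :+ (:- (q :* τ)) :* y) refl
        (+ p) σ x (+ q) τ y))
    combine (Bézout.-+ p q eq) = ℤ.- (+ p ℤ.* σ) , + q ℤ.* τ , sym (trans
      (trans (lift q p (∣ y ∣) (∣ x ∣) eq)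
        (cong₂ (λ i j → + q ℤ.* j ℤ.- + p ℤ.* i) (proj₂ (∣∣-multiple x)) (proj₂ (∣∣-multiple y))))
      (solve 6 (λ p σ x q τ y → q :* (τ :* y) :- p :* (σ :* x) := (:- (p :* σ)) :* x :+ q :* τ :* y) refl
        (+ p) σ x (+ q) τ y))

  primitive-part : ∀ x y → ¬ (x ≡ 0ℤ × y ≡ 0ℤ) →
                   ∃[ g ] (g ≢ 0ℤ × ∃[ P ] (x ≡ g ℤ.* a P × y ≡ g ℤ.* b P))
  primitive-part x y nz = + g , g≢0 , record { a = x/g ; b = y/g ; u = s ; v = t ; bézout = eq } ,
    trans (ℤ._∣_.equality g∣x) (ℤ.*-comm x/g (+ g)) , trans (ℤ._∣_.equality g∣y) (ℤ.*-comm y/g (+ g))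
    where
    open ℤ-Solver.+-*-Solver
    open ≡-Reasoning
    g = gcd (∣ x ∣) (∣ y ∣)

    g≢0 : + g ≢ 0ℤ
    g≢0 eq = nz (ℤ.∣i∣≡0⇒i≡0 (gcd[m,n]≡0⇒m≡0 (ℤ.+-injective eq)) ,
                 ℤ.∣i∣≡0⇒i≡0 (gcd[m,n]≡0⇒n≡0 (∣ x ∣) (ℤ.+-injective eq)))

    g∣x = ℤ.∣ᵤ⇒∣ {+ g} {x} (gcd[m,n]∣m (∣ x ∣) (∣ y ∣))
    g∣y = ℤ.∣ᵤ⇒∣ {+ g} {y} (gcd[m,n]∣n (∣ x ∣) (∣ y ∣))
    x/g = ℤ._∣_.quotient g∣x
    y/g = ℤ._∣_.quotient g∣y
    s = proj₁ (bézout-signed x y)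
    t = proj₁ (proj₂ (bézout-signed x y))

    eq : s ℤ.* x/g ℤ.+ t ℤ.* y/g ≡ 1ℤ
    eq = ℤ.*-cancelʳ-≡ _ _ (+ g) {{ℤ.≢-nonZero g≢0}} (begin
      (s ℤ.* x/g ℤ.+ t ℤ.* y/g) ℤ.* + g
        ≡⟨ solve 5 (λ s x t y g → (s :* x :+ t :* y) :* g := s :* (x :* g) :+ t :* (y :* g)) refl s x/g t y/g (+ g) ⟩
      s ℤ.* (x/g ℤ.* + g) ℤ.+ t ℤ.* (y/g ℤ.* + g)
        ≡⟨ cong₂ (λ i j → s ℤ.* i ℤ.+ t ℤ.* j) (ℤ._∣_.equality g∣x) (ℤ._∣_.equality g∣y) ⟨
      s ℤ.* x ℤ.+ t ℤ.* y
        ≡⟨ proj₂ (proj₂ (bézout-signed x y)) ⟩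
      + g
        ≡⟨ ℤ.*-identityˡ (+ g) ⟨
      1ℤ ℤ.* + g ∎)

-- The local rings of ℤ

-- Abstract, because fromℤ n is a constructor form on which the arithmetic of ℚ
-- would unfold.
abstract
  ι : ℤ → ℚ
  ι = fromℤ

  ι-0 : ι 0ℤ ≡ 0ℚ
  ι-0 = refl

  ι-1 : ι 1ℤ ≡ 1ℚ
  ι-1 = refl

  ι-+ : ∀ m n → ι (m ℤ.+ n) ≡ ι m + ι n
  ι-+ m n = toℚᵘ-injective (ℚᵘ.≃-sym (ℚᵘ.≃-trans (toℚᵘ-homo-+ (fromℤ m) (fromℤ n))
    (ℚᵘ.*≡* (cong (ℤ._* 1ℤ) (cong₂ ℤ._+_ (ℤ.*-identityʳ m) (ℤ.*-identityʳ n))))))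

  ι-* : ∀ m n → ι (m ℤ.* n) ≡ ι m * ι n
  ι-* m n = toℚᵘ-injective (ℚᵘ.≃-sym (toℚᵘ-homo-* (fromℤ m) (fromℤ n)))

  ι-neg : ∀ n → ι (ℤ.- n) ≡ - ι n
  ι-neg n = toℚᵘ-injective (ℚᵘ.≃-sym (toℚᵘ-homo‿- (fromℤ n)))

  ι-injective : ∀ {m n} → ι m ≡ ι n → m ≡ n
  ι-injective = cong ↥_

  *-↧ : ∀ q → q * ι (↧ q) ≡ ι (↥ q)
  *-↧ q@record{} = toℚᵘ-injective (ℚᵘ.≃-trans (toℚᵘ-homo-* q (fromℤ (↧ q)))
    (ℚᵘ.*≡* (trans (ℤ.*-identityʳ (↥ q ℤ.* ↧ q)) (cong (↥ q ℤ.*_) (cong +_ (sym (ℕ.*-identityʳ (↧ₙ q))))))))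

ι≡0⇒≡0 : ∀ {n} → ι n ≡ 0ℚ → n ≡ 0ℤ
ι≡0⇒≡0 eq = ι-injective (trans eq (sym ι-0))

*-cancelʳ-≢0 : ∀ {x y z} → z ≢ 0ℚ → x * z ≡ y * z → x ≡ y
*-cancelʳ-≢0 {x} {y} {z} z≢0 eq = trans (sym (undo x)) (trans (cong (_* 1/ z) eq) (undo y))
  where
  instance _ = ≢-nonZero z≢0
  undo : ∀ x → x * z * 1/ z ≡ x
  undo x = trans (*-assoc x z (1/ z)) (trans (cong (x *_) (*-inverseʳ z)) (*-identityʳ x))

quotient-exists : ∀ x {y} → y ≢ 0ℚ → ∃[ r ] (r * y ≡ x)
quotient-exists x {y} y≢0 = x * 1/ y ,
  trans (*-assoc x (1/ y) y) (trans (cong (x *_) (*-inverseˡ y)) (*-identityʳ x))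
  where instance _ = ≢-nonZero y≢0

fraction : ∀ q {n d} → q * ι d ≡ ι n → ↥ q ℤ.* d ≡ n ℤ.* ↧ q
fraction q {n} {d} eq = ι-injective (begin
  ι (↥ q ℤ.* d)               ≡⟨ ι-* (↥ q) d ⟩
  ι (↥ q) * ι d           ≡⟨ cong (_* ι d) (*-↧ q) ⟨
  q * ι (↧ q) * ι d       ≡⟨ solve 3 (λ q a b → q :* a :* b := q :* b :* a) refl q (ι (↧ q)) (ι d) ⟩
  q * ι d * ι (↧ q)       ≡⟨ cong (_* ι (↧ q)) eq ⟩
  ι n * ι (↧ q)           ≡⟨ ι-* n (↧ q) ⟨
  ι (n ℤ.* ↧ q)               ∎)
  where
  open ≡-Reasoning
  open +-*-Solver

module Localization {p : ℕ} (p-prime : Prime p) where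

  R : ℚ → Set
  R q = q ∈ℤ₍ p ₎

  private
    p∤* : ∀ {d e} → ¬ p ℕ.∣ ∣ d ∣ → ¬ p ℕ.∣ ∣ e ∣ → ¬ p ℕ.∣ ∣ d ℤ.* e ∣
    p∤* {d} {e} p∤d p∤e p∣de = [ p∤d , p∤e ]′
      (euclidsLemma ∣ d ∣ ∣ e ∣ p-prime (subst (p ℕ.∣_) (ℤ.abs-* d e) p∣de))

    p∤1 : ¬ p ℕ.∣ 1
    p∤1 p∣1 = ℕ.nonTrivial⇒≢1 {{prime⇒nonTrivial p-prime}} (ℕ.∣1⇒≡1 p∣1)

    p∤⇒≢0 : ∀ {d} → ¬ p ℕ.∣ ∣ d ∣ → ι d ≢ 0ℚ
    p∤⇒≢0 p∤d eq = p∤d (subst (λ n → p ℕ.∣ ∣ n ∣) (sym (ι≡0⇒≡0 eq)) (p ℕ.∣0))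

  -- The denominator in lowest terms divides any other one, so closure properties follow from
  -- unreduced fractions.
  fraction∈ : ∀ {q n d} → ¬ p ℕ.∣ ∣ d ∣ → q * ι d ≡ ι n → R q
  fraction∈ {q@record{}} {n} {d} p∤d eq p∣↧q = p∤d (ℕ.∣-trans p∣↧q (ℕ.coprime-divisor (ℕ.sym (ℚ-coprime q))
    (subst (↧ₙ q ℕ.∣_) (trans (sym (ℤ.abs-* n (↧ q))) (trans (cong ∣_∣ (sym (fraction q eq))) (ℤ.abs-* (↥ q) d))) (ℕ.n∣m*n ∣ n ∣))))
    where
    ℚ-coprime : ∀ q → ℕ.Coprime ∣ ↥ q ∣ (↧ₙ q)
    ℚ-coprime (mkℚ _ _ c) = ℕ.recompute c

  ι∈ : ∀ n → R (ι n)
  ι∈ n = fraction∈ {ι n} {n} {1ℤ} p∤1 (trans (cong (ι n *_) ι-1) (*-identityʳ (ι n)))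

  isSubring : IsSubring R
  isSubring = record
    { 1∈  = subst R ι-1 (ι∈ 1ℤ)
    ; -1∈ = subst R (trans (ι-neg 1ℤ) (cong -_ ι-1)) (ι∈ (ℤ.- 1ℤ))
    ; +∈  = λ {x} {y} x∈ y∈ → fraction∈ {x + y} {d = ↧ x ℤ.* ↧ y} (p∤* {↧ x} {↧ y} x∈ y∈) (begin
        (x + y) * ι (↧ x ℤ.* ↧ y)
          ≡⟨ cong ((x + y) *_) (ι-* (↧ x) (↧ y)) ⟩
        (x + y) * (ι (↧ x) * ι (↧ y))
          ≡⟨ solve 4 (λ x y a b → (x :+ y) :* (a :* b) := (x :* a) :* b :+ (y :* b) :* a) refl x y (ι (↧ x)) (ι (↧ y)) ⟩
        x * ι (↧ x) * ι (↧ y) + y * ι (↧ y) * ι (↧ x)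
          ≡⟨ cong₂ (λ u v → u * ι (↧ y) + v * ι (↧ x)) (*-↧ x) (*-↧ y) ⟩
        ι (↥ x) * ι (↧ y) + ι (↥ y) * ι (↧ x)
          ≡⟨ cong₂ _+_ (ι-* (↥ x) (↧ y)) (ι-* (↥ y) (↧ x)) ⟨
        ι (↥ x ℤ.* ↧ y) + ι (↥ y ℤ.* ↧ x)
          ≡⟨ ι-+ (↥ x ℤ.* ↧ y) (↥ y ℤ.* ↧ x) ⟨
        ι (↥ x ℤ.* ↧ y ℤ.+ ↥ y ℤ.* ↧ x) ∎)
    ; *∈  = λ {x} {y} x∈ y∈ → fraction∈ {x * y} {d = ↧ x ℤ.* ↧ y} (p∤* {↧ x} {↧ y} x∈ y∈) (begin
        (x * y) * ι (↧ x ℤ.* ↧ y)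
          ≡⟨ cong ((x * y) *_) (ι-* (↧ x) (↧ y)) ⟩
        (x * y) * (ι (↧ x) * ι (↧ y))
          ≡⟨ solve 4 (λ x y a b → (x :* y) :* (a :* b) := (x :* a) :* (y :* b)) refl x y (ι (↧ x)) (ι (↧ y)) ⟩
        x * ι (↧ x) * (y * ι (↧ y))
          ≡⟨ cong₂ _*_ (*-↧ x) (*-↧ y) ⟩
        ι (↥ x) * ι (↥ y)
          ≡⟨ ι-* (↥ x) (↥ y) ⟨
        ι (↥ x ℤ.* ↥ y) ∎)
    }
    where
    open ≡-Reasoning
    open +-*-Solver

  -- The principal ideal of δ: with δ = p it is the maximal ideal, with δ a cross product it
  -- measures how close two points are.
  Multiple : ℚ → ℚ → Set
  Multiple δ q = ∃[ r ] (R r × q ≡ r * δ)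

  Multiple-isIdeal : ∀ δ → IsIdeal R (Multiple δ)
  Multiple-isIdeal δ = record
    { zero∈     = 0ℚ , IsSubring.0∈ isSubring , sym (*-zeroˡ δ)
    ; sum∈      = λ (r , r∈ , x≡) (s , s∈ , y≡) → r + s , IsSubring.+∈ isSubring {r} {s} r∈ s∈ ,
                    trans (cong₂ _+_ x≡ y≡) (sym (*-distribʳ-+ δ r s))
    ; multiple∈ = λ {t} t∈ (r , r∈ , x≡) → t * r , IsSubring.*∈ isSubring {t} {r} t∈ r∈ ,
                    trans (cong (t *_) x≡) (sym (*-assoc t r δ))
    }

  𝔪 : ℚ → Set
  𝔪 = Multiple (ι (+ p))

  1∉𝔪 : ¬ 𝔪 1ℚ
  1∉𝔪 (r , r∈ , 1≡rp) = r∈ (divides-↧ (fraction r {1ℤ} {+ p} (trans (sym 1≡rp) (sym ι-1))))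
    where
    divides-↧ : ↥ r ℤ.* + p ≡ 1ℤ ℤ.* ↧ r → p ℕ.∣ ↧ₙ r
    divides-↧ eq = subst (p ℕ.∣_) (trans (sym (ℤ.abs-* (↥ r) (+ p))) (cong ∣_∣ (trans eq (ℤ.*-identityˡ (↧ r))))) (ℕ.n∣m*n ∣ ↥ r ∣)

  Unit : ℚ → Set
  Unit q = ∃[ r ] (R r × r * q ≡ 1ℚ)

  𝔪⊎unit : ∀ {q} → R q → 𝔪 q ⊎ Unit q
  𝔪⊎unit {q} q∈ with p ℕ.∣? ∣ ↥ q ∣
  ... | yes p∣n = inj₁ (r , fraction∈ {r} {k} {↧ q} q∈ r↧≡k , *-cancelʳ-≢0 ↧≢0 (begin
      q * ι (↧ q)                   ≡⟨ *-↧ q ⟩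
      ι (↥ q)                       ≡⟨ cong ι (ℤ._∣_.equality p∣ℤ) ⟩
      ι (k ℤ.* + p)                 ≡⟨ ι-* k (+ p) ⟩
      ι k * ι (+ p)             ≡⟨ cong (_* ι (+ p)) r↧≡k ⟨
      r * ι (↧ q) * ι (+ p)     ≡⟨ solve 3 (λ r a b → r :* a :* b := r :* b :* a) refl r (ι (↧ q)) (ι (+ p)) ⟩
      r * ι (+ p) * ι (↧ q)     ∎))
    where
    open ≡-Reasoning
    open +-*-Solver
    p∣ℤ = ℤ.∣ᵤ⇒∣ {+ p} {↥ q} p∣n
    k = ℤ._∣_.quotient p∣ℤ
    ↧≢0 : ι (↧ q) ≢ 0ℚ
    ↧≢0 = p∤⇒≢0 {↧ q} q∈
    r = proj₁ (quotient-exists (ι k) ↧≢0)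
    r↧≡k : r * ι (↧ q) ≡ ι k
    r↧≡k = proj₂ (quotient-exists (ι k) ↧≢0)
  ... | no p∤n = inj₂ (r , fraction∈ {r} {↧ q} {↥ q} p∤n r↥≡↧ , *-cancelʳ-≢0 (p∤⇒≢0 {↧ q} q∈) (begin
      r * q * ι (↧ q)   ≡⟨ *-assoc r q (ι (↧ q)) ⟩
      r * (q * ι (↧ q)) ≡⟨ cong (r *_) (*-↧ q) ⟩
      r * ι (↥ q)       ≡⟨ r↥≡↧ ⟩
      ι (↧ q)           ≡⟨ *-identityˡ (ι (↧ q)) ⟨
      1ℚ * ι (↧ q)      ∎))
    where
    open ≡-Reasoning
    r = proj₁ (quotient-exists (ι (↧ q)) (p∤⇒≢0 {↥ q} p∤n))
    r↥≡↧ : r * ι (↥ q) ≡ ι (↧ q)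
    r↥≡↧ = proj₂ (quotient-exists (ι (↧ q)) (p∤⇒≢0 {↥ q} p∤n))

¬prime∣⇒≡1 : ∀ n .{{_ : ℕ.NonZero n}} → (∀ p → Prime p → ¬ p ℕ.∣ n) → n ≡ 1
¬prime∣⇒≡1 n ∤n with factorise n
... | record { factors = []     ; isFactorisation = eq } = eq
... | record { factors = p ∷ ps ; isFactorisation = eq ; factorsPrime = p-prime ∷ _ } =
  contradiction (subst (p ℕ.∣_) (sym eq) (ℕ.m∣m*n (product ps))) (∤n p p-prime)

-- For m ≠ 0 the quotients at all primes are the same rational number, whose denominator then has no
-- prime factor. The prime 2 serves only to get hold of one quotient.
locally-divides⇒∣ : ∀ {m n} → (∀ p → Prime p → ∃[ s ] (s ∈ℤ₍ p ₎ × s * ι m ≡ ι n)) → ∣ m ∣ ℕ.∣ ∣ n ∣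
locally-divides⇒∣ {m} {n} local with m ℤ.≟ 0ℤ
... | yes refl with s , _ , eq ← local 2 prime[2] =
  subst (λ k → 0 ℕ.∣ ∣ k ∣) (ι-injective (trans (trans ι-0 (trans (sym (*-zeroʳ s)) (cong (s *_) (sym ι-0)))) eq)) ℕ.∣-refl
... | no m≢0 with q , q∈ , eq ← local 2 prime[2] =
  subst (∣ m ∣ ℕ.∣_) (trans (sym (ℤ.abs-* (↥ q) m)) (cong ∣_∣ ↥q*m≡n)) (ℕ.n∣m*n ∣ ↥ q ∣)
  where
  ↧q≡1 : ↧ₙ q ≡ 1
  ↧q≡1 = ¬prime∣⇒≡1 (↧ₙ q) λ p p-prime → let s , s∈ , eq′ = local p p-prime in
    subst (_∈ℤ₍ p ₎) (*-cancelʳ-≢0 {s} {q} (m≢0 ∘ ι≡0⇒≡0) (trans eq′ (sym eq))) s∈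
  ↥q*m≡n : ↥ q ℤ.* m ≡ n
  ↥q*m≡n = trans (fraction q eq) (trans (cong (λ d → n ℤ.* + d) ↧q≡1) (ℤ.*-identityʳ n))

-- Good reduction

1^n≡1 : ∀ n → 1ℚ ^ n ≡ 1ℚ
1^n≡1 zero    = refl
1^n≡1 (suc n) = trans (*-identityˡ (1ℚ ^ n)) (1^n≡1 n)

^-inverse : ∀ {r x} → r * x ≡ 1ℚ → ∀ n → r ^ n * x ^ n ≡ 1ℚ
^-inverse {r} {x} rx≡1 n = trans (sym (^-distrib-* r x n)) (trans (cong (_^ n) rx≡1) (1^n≡1 n))

aℚ bℚ uℚ vℚ : Primitive → ℚ
aℚ = ι ∘ Primitive.a
bℚ = ι ∘ Primitive.b
uℚ = ι ∘ Primitive.u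
vℚ = ι ∘ Primitive.v

bézoutℚ : ∀ P → uℚ P * aℚ P + vℚ P * bℚ P ≡ 1ℚ
bézoutℚ P = trans (sym (trans (ι-+ (u ℤ.* a) (v ℤ.* b)) (cong₂ _+_ (ι-* u a) (ι-* v b)))) (trans (cong ι bézout) ι-1)
  where open Primitive P

crossℚ : ∀ P Q → ι (cross P Q) ≡ aℚ P * bℚ Q + - (bℚ P * aℚ Q)
crossℚ P Q = trans (ι-+ (a P ℤ.* b Q) (ℤ.- (b P ℤ.* a Q)))
  (cong₂ _+_ (ι-* (a P) (b Q)) (trans (ι-neg (b P ℤ.* a Q)) (cong -_ (ι-* (b P) (a Q)))))
  where open Primitive

-- The factor by which (x , y) exceeds the primitive vector P.
content : Primitive → ℚ → ℚ → ℚ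
content P x y = uℚ P * x + vℚ P * y

-- The Bézout coefficients produce the factor without a division, so it stays in ℤ₍ₚ₎ whenever `x`
-- and `y` do.
content-multiple : ∀ P {x y} → aℚ P * y ≡ bℚ P * x → x ≡ content P x y * aℚ P × y ≡ content P x y * bℚ P
content-multiple P {x} {y} eq = sym x≡ , sym y≡
  where
  open ≡-Reasoning
  open +-*-Solver
  x≡ : content P x y * aℚ P ≡ x
  x≡ = begin
    (uℚ P * x + vℚ P * y) * aℚ P        ≡⟨ solve 5 (λ u v x y a → (u :* x :+ v :* y) :* a := u :* a :* x :+ v :* (a :* y)) refl (uℚ P) (vℚ P) x y (aℚ P) ⟩
    uℚ P * aℚ P * x + vℚ P * (aℚ P * y) ≡⟨ cong (λ z → uℚ P * aℚ P * x + vℚ P * z) eq ⟩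
    uℚ P * aℚ P * x + vℚ P * (bℚ P * x) ≡⟨ solve 5 (λ u v x a b → u :* a :* x :+ v :* (b :* x) := (u :* a :+ v :* b) :* x) refl (uℚ P) (vℚ P) x (aℚ P) (bℚ P) ⟩
    (uℚ P * aℚ P + vℚ P * bℚ P) * x     ≡⟨ cong (_* x) (bézoutℚ P) ⟩
    1ℚ * x                              ≡⟨ *-identityˡ x ⟩
    x                                   ∎
  y≡ : content P x y * bℚ P ≡ y
  y≡ = begin
    (uℚ P * x + vℚ P * y) * bℚ P        ≡⟨ solve 5 (λ u v x y b → (u :* x :+ v :* y) :* b := u :* (b :* x) :+ v :* b :* y) refl (uℚ P) (vℚ P) x y (bℚ P) ⟩
    uℚ P * (bℚ P * x) + vℚ P * bℚ P * y ≡⟨ cong (λ z → uℚ P * z + vℚ P * bℚ P * y) eq ⟨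
    uℚ P * (aℚ P * y) + vℚ P * bℚ P * y ≡⟨ solve 5 (λ u v y a b → u :* (a :* y) :+ v :* b :* y := (u :* a :+ v :* b) :* y) refl (uℚ P) (vℚ P) y (aℚ P) (bℚ P) ⟩
    (uℚ P * aℚ P + vℚ P * bℚ P) * y     ≡⟨ cong (_* y) (bézoutℚ P) ⟩
    1ℚ * y                              ≡⟨ *-identityˡ y ⟩
    y                                   ∎

-- The cross product of the two image vectors before they are made primitive.
wronskian : ∀ {d} (F G : Form d) (P Q : Primitive) → ℚ
wronskian F G P Q = eval F (aℚ P) (bℚ P) * eval G (aℚ Q) (bℚ Q) + - (eval G (aℚ P) (bℚ P) * eval F (aℚ Q) (bℚ Q))

wronskian-cross : ∀ {d} (F G : Form d) (P Q P′ Q′ : Primitive) {κ μ} →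
  eval F (aℚ P) (bℚ P) ≡ κ * aℚ P′ → eval G (aℚ P) (bℚ P) ≡ κ * bℚ P′ →
  eval F (aℚ Q) (bℚ Q) ≡ μ * aℚ Q′ → eval G (aℚ Q) (bℚ Q) ≡ μ * bℚ Q′ →
  wronskian F G P Q ≡ κ * μ * ι (cross P′ Q′)
wronskian-cross F G P Q P′ Q′ {κ} {μ} e₁ e₂ e₃ e₄ = trans
  (cong₂ (λ s t → s + - t) (cong₂ _*_ e₁ e₄) (cong₂ _*_ e₂ e₃))
  (trans (solve 6 (λ κ μ a b c d → (κ :* a) :* (μ :* d) :- (κ :* b) :* (μ :* c) := κ :* μ :* (a :* d :- b :* c)) refl
      κ μ (aℚ P′) (bℚ P′) (aℚ Q′) (bℚ Q′))
    (cong (κ * μ *_) (sym (crossℚ P′ Q′))))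
  where open +-*-Solver

module LocalStep {p : ℕ} (p-prime : Prime p) where
  open Localization p-prime
  open IsSubring isSubring
  open Subring isSubring
  open +-*-Solver

  a∈ : ∀ P → R (aℚ P)
  a∈ P = ι∈ (Primitive.a P)
  b∈ : ∀ P → R (bℚ P)
  b∈ P = ι∈ (Primitive.b P)

  unit-coordinate : ∀ P → Unit (aℚ P) ⊎ Unit (bℚ P)
  unit-coordinate P with 𝔪⊎unit {aℚ P} (a∈ P) | 𝔪⊎unit {bℚ P} (b∈ P)
  ... | inj₂ unit | _         = inj₁ unit
  ... | inj₁ _    | inj₂ unit = inj₂ unit
  ... | inj₁ a∈𝔪  | inj₁ b∈𝔪  = contradiction
    (subst 𝔪 (bézoutℚ P) (sum∈ (multiple∈ {uℚ P} (ι∈ (Primitive.u P)) a∈𝔪) (multiple∈ {vℚ P} (ι∈ (Primitive.v P)) b∈𝔪))) 1∉𝔪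
    where open IsIdeal (Multiple-isIdeal (ι (+ p)))

  module _ {d} (F G : Form (suc d)) (F∈ : ∀ i → R (F i)) (G∈ : ∀ i → R (G i)) (Res∉𝔪 : ¬ 𝔪 (Res F G)) where
    open IsIdeal (Multiple-isIdeal (ι (+ p)))
    open Ideal (Multiple-isIdeal (ι (+ p)))

    -- Modulo `p` the point is [t : 1] if its second coordinate is a unit and [1 : 0] otherwise; in
    -- either case the resultant would fall into 𝔪.
    no-common-zero-mod : ∀ P → ¬ (𝔪 (eval F (aℚ P) (bℚ P)) × 𝔪 (eval G (aℚ P) (bℚ P)))
    no-common-zero-mod P (F∈𝔪 , G∈𝔪) =
      [ (λ y∈𝔪 → [ (λ x-unit → at-infinity x-unit y∈𝔪) , affine ]′ (unit-coordinate P)) , affine ]′ (𝔪⊎unit {y} (b∈ P))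
      where
      x = aℚ P
      y = bℚ P

      affine : ¬ Unit y
      affine (r , r∈ , ry≡1) = Res∉𝔪 (Res-root∈ F G F∈ G∈ {r * x} (*∈ {r} {x} r∈ (a∈ P)) (scaled F F∈𝔪) (scaled G G∈𝔪))
        where
        scaled : ∀ H → 𝔪 (eval H x y) → 𝔪 (eval H (r * x) 1ℚ)
        scaled H H∈𝔪 = subst 𝔪 (trans (sym (eval-scale H r x y)) (cong (eval H (r * x)) ry≡1)) (multiple∈ {r ^ suc d} (^∈ {r} r∈ (suc d)) H∈𝔪)

      at-infinity : Unit x → ¬ 𝔪 y
      at-infinity (r , r∈ , rx≡1) y∈𝔪 = Res∉𝔪 (Res-leading∈ F G F∈ G∈ (leading F F∈ F∈𝔪) (leading G G∈ G∈𝔪))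
        where
        s = r ^ suc d
        s∈ : R s
        s∈ = ^∈ {r} r∈ (suc d)
        -- Removing from H(x, y) its part divisible by `y` leaves the leading coefficient times a
        -- power of the unit `x`.
        leading : ∀ H → (∀ i → R (H i)) → 𝔪 (eval H x y) → 𝔪 (H zero)
        leading H H∈ H∈𝔪 = subst 𝔪
          (trans (cong (λ z → s * z + (- (s * e)) * y) (eval-suc H x y))
            (trans (solve 5 (λ s h w y e → s :* (h :* w :+ y :* e) :+ (:- (s :* e)) :* y := h :* (s :* w)) refl
                s (H zero) (x ^ suc d) y e)
              (trans (cong (H zero *_) (^-inverse {r} {x} rx≡1 (suc d))) (*-identityʳ (H zero)))))
          (sum∈ (multiple∈ {s} s∈ H∈𝔪)
            (multiple∈ { - (s * e)} (-∈ {s * e} (*∈ {s} {e} s∈ (eval∈ (tail H) (H∈ ∘ suc) {x} {y} (a∈ P) (b∈ P)))) y∈𝔪))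
          where e = eval (tail H) x y

    -- A content in 𝔪 would divide both values, making `P` a common zero modulo `p`.
    content-unit : ∀ P P′ → aℚ P′ * eval G (aℚ P) (bℚ P) ≡ bℚ P′ * eval F (aℚ P) (bℚ P) →
                   Unit (content P′ (eval F (aℚ P) (bℚ P)) (eval G (aℚ P) (bℚ P)))
    content-unit P P′ eq = [ (λ κ∈𝔪 → contradiction (common-zero κ∈𝔪) (no-common-zero-mod P)) , (λ unit → unit) ]′ (𝔪⊎unit {κ} κ∈)
      where
      x = eval F (aℚ P) (bℚ P)
      y = eval G (aℚ P) (bℚ P)
      κ = content P′ x y
      κ∈ : R κ
      κ∈ = +∈ {uℚ P′ * x} {vℚ P′ * y}
        (*∈ {uℚ P′} {x} (ι∈ (Primitive.u P′)) (eval∈ F F∈ {aℚ P} {bℚ P} (a∈ P) (b∈ P)))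
        (*∈ {vℚ P′} {y} (ι∈ (Primitive.v P′)) (eval∈ G G∈ {aℚ P} {bℚ P} (a∈ P) (b∈ P)))
      common-zero : 𝔪 κ → 𝔪 x × 𝔪 y
      common-zero κ∈𝔪 = subst 𝔪 (sym (proj₁ (content-multiple P′ eq))) (multiple∈ʳ {aℚ P′} (a∈ P′) κ∈𝔪) ,
                        subst 𝔪 (sym (proj₂ (content-multiple P′ eq))) (multiple∈ʳ {bℚ P′} (b∈ P′) κ∈𝔪)

  module _ {d} (F G : Form d) (F∈ : ∀ i → R (F i)) (G∈ : ∀ i → R (G i)) where

    -- Modulo the cross product, c P = e Q where (c , e) = (b Q , b P) or
    -- (a Q , a P), so (F , G) takes proportional values at P and Q.
    wronskian-multiple : ∀ P Q → Multiple (ι (cross P Q)) (wronskian F G P Q)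
    wronskian-multiple P Q = [ a-unit-case , b-unit-case ]′ (unit-coordinate Q)
      where
      x = aℚ P
      y = bℚ P
      x′ = aℚ Q
      y′ = bℚ Q
      δ = ι (cross P Q)
      F₁ = eval F x y
      G₁ = eval G x y
      F₂ = eval F x′ y′
      G₂ = eval G x′ y′
      open IsIdeal (Multiple-isIdeal δ)
      open Congruence isSubring (Multiple-isIdeal δ)

      values : ∀ {c e} → R c → R e → c * x ≋ e * x′ → c * y ≋ e * y′ → ∀ H → (∀ i → R (H i)) →
               c ^ d * eval H x y ≋ e ^ d * eval H x′ y′
      values {c} {e} c∈ e∈ cx≋ex′ cy≋ey′ H H∈ = subst₂ _≋_ (eval-scale H c x y) (eval-scale H e x′ y′)
        (eval-cong-≋ H H∈ {c * x} {e * x′} {c * y} {e * y′}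
          (*∈ {c} {x} c∈ (a∈ P)) (*∈ {e} {x′} e∈ (a∈ Q)) (*∈ {c} {y} c∈ (b∈ P)) (*∈ {e} {y′} e∈ (b∈ Q)) cx≋ex′ cy≋ey′)

      proportional : ∀ {c e} → R c → R e → Unit c → c * x ≋ e * x′ → c * y ≋ e * y′ → Multiple δ (wronskian F G P Q)
      proportional {c} {e} c∈ e∈ (r , r∈ , rc≡1) cx≋ex′ cy≋ey′ = subst (Multiple δ) eq
        (multiple∈ {r ^ d} (^∈ {r} r∈ d) (sum∈
          (multiple∈ {G₂} (eval∈ G G∈ {x′} {y′} (a∈ Q) (b∈ Q)) (values {c} {e} c∈ e∈ cx≋ex′ cy≋ey′ F F∈))
          (multiple∈ { - F₂} (-∈ {F₂} (eval∈ F F∈ {x′} {y′} (a∈ Q) (b∈ Q))) (values {c} {e} c∈ e∈ cx≋ex′ cy≋ey′ G G∈))))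
        where
        eq : r ^ d * (G₂ * (c ^ d * F₁ + - (e ^ d * F₂)) + - F₂ * (c ^ d * G₁ + - (e ^ d * G₂))) ≡ wronskian F G P Q
        eq = trans (solve 7 (λ r c e f g f′ g′ → r :* (g′ :* (c :* f :- e :* f′) :+ (:- f′) :* (c :* g :- e :* g′)) := (r :* c) :* (f :* g′ :- g :* f′))
                     refl (r ^ d) (c ^ d) (e ^ d) F₁ G₁ F₂ G₂)
               (trans (cong (_* wronskian F G P Q) (^-inverse {r} {c} rc≡1 d)) (*-identityˡ (wronskian F G P Q)))

      swapped : ∀ u v → u * v ≋ v * u
      swapped u v = subst (u * v ≋_) (*-comm u v) (refl-≋ {u * v})

      a-unit-case : Unit x′ → Multiple δ (wronskian F G P Q)
      a-unit-case unit = proportional {x′} {x} (a∈ Q) (a∈ P) unit (swapped x′ x)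
        (- 1ℚ , -1∈ , trans (solve 4 (λ x y x′ y′ → x′ :* y :- x :* y′ := (:- con 1ℚ) :* (x :* y′ :- y :* x′)) refl x y x′ y′)
          (cong (- 1ℚ *_) (sym (crossℚ P Q))))

      b-unit-case : Unit y′ → Multiple δ (wronskian F G P Q)
      b-unit-case unit = proportional {y′} {y} (b∈ Q) (b∈ P) unit
        (1ℚ , 1∈ , trans (solve 4 (λ x y x′ y′ → y′ :* x :- y :* x′ := con 1ℚ :* (x :* y′ :- y :* x′)) refl x y x′ y′)
          (cong (1ℚ *_) (sym (crossℚ P Q))))
        (swapped y′ y)

  -- The Wronskian is a multiple of the old cross product, and it is the new one times two contents,
  -- which are units.
  cross-multiple : ∀ {d} (F G : Form d) → CoprimeForms F G → (∀ i → R (F i)) → (∀ i → R (G i)) → ¬ 𝔪 (Res F G) →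
    ∀ P Q P′ Q′ →
    aℚ P′ * eval G (aℚ P) (bℚ P) ≡ bℚ P′ * eval F (aℚ P) (bℚ P) →
    aℚ Q′ * eval G (aℚ Q) (bℚ Q) ≡ bℚ Q′ * eval F (aℚ Q) (bℚ Q) →
    Multiple (ι (cross P Q)) (ι (cross P′ Q′))
  -- A constant map has resultant 1 whatever its values, so the contents are only known to be
  -- nonzero, by coprimality. The Wronskian vanishes, and so does the new cross product.
  cross-multiple {zero} F G coprime F∈ G∈ Res∉𝔪 P Q P′ Q′ eqP eqQ = 0ℚ , 0∈ , trans
    (*-cancelʳ-≢0 (*-≢0 κ≢0 μ≢0) (trans (*-comm (ι (cross P′ Q′)) (κ * μ))
      (trans (sym (wronskian-cross F G P Q P′ Q′ {κ} {μ} F₁≡ G₁≡ F₂≡ G₂≡))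
        (trans (solve 2 (λ f g → f :* g :- g :* f := con 0ℚ) refl (eval F 0ℚ 0ℚ) (eval G 0ℚ 0ℚ)) (sym (*-zeroˡ (κ * μ)))))))
    (sym (*-zeroˡ (ι (cross P Q))))
    where
    κ = content P′ (eval F (aℚ P) (bℚ P)) (eval G (aℚ P) (bℚ P))
    μ = content Q′ (eval F (aℚ Q) (bℚ Q)) (eval G (aℚ Q) (bℚ Q))
    F₁≡ = proj₁ (content-multiple P′ eqP)
    G₁≡ = proj₂ (content-multiple P′ eqP)
    F₂≡ = proj₁ (content-multiple Q′ eqQ)
    G₂≡ = proj₂ (content-multiple Q′ eqQ)
    nonzero : ¬ (eval F 1ℚ 0ℚ ≡ 0ℚ × eval G 1ℚ 0ℚ ≡ 0ℚ)
    nonzero = noCommonZero {F = F} {G} coprime {1ℚ} {0ℚ} λ ()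
    κ≢0 : κ ≢ 0ℚ
    κ≢0 κ≡0 = nonzero (trans F₁≡ (trans (cong (_* aℚ P′) κ≡0) (*-zeroˡ (aℚ P′))) , trans G₁≡ (trans (cong (_* bℚ P′) κ≡0) (*-zeroˡ (bℚ P′))))
    μ≢0 : μ ≢ 0ℚ
    μ≢0 μ≡0 = nonzero (trans F₂≡ (trans (cong (_* aℚ Q′) μ≡0) (*-zeroˡ (aℚ Q′))) , trans G₂≡ (trans (cong (_* bℚ Q′) μ≡0) (*-zeroˡ (bℚ Q′))))
  cross-multiple {suc d} F G coprime F∈ G∈ Res∉𝔪 P Q P′ Q′ eqP eqQ = subst (Multiple (ι (cross P Q))) eq
    (multiple∈ {r * s} (*∈ {r} {s} r∈ s∈) (wronskian-multiple F G F∈ G∈ P Q))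
    where
    open IsIdeal (Multiple-isIdeal (ι (cross P Q)))
    κ = content P′ (eval F (aℚ P) (bℚ P)) (eval G (aℚ P) (bℚ P))
    μ = content Q′ (eval F (aℚ Q) (bℚ Q)) (eval G (aℚ Q) (bℚ Q))
    κ-unit = content-unit F G F∈ G∈ Res∉𝔪 P P′ eqP
    μ-unit = content-unit F G F∈ G∈ Res∉𝔪 Q Q′ eqQ
    r = proj₁ κ-unit
    s = proj₁ μ-unit
    r∈ = proj₁ (proj₂ κ-unit)
    s∈ = proj₁ (proj₂ μ-unit)
    D′ = ι (cross P′ Q′)
    eq : r * s * wronskian F G P Q ≡ D′
    eq = trans (cong (r * s *_) (wronskian-cross F G P Q P′ Q′ {κ} {μ}
           (proj₁ (content-multiple P′ eqP)) (proj₂ (content-multiple P′ eqP))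
           (proj₁ (content-multiple Q′ eqQ)) (proj₂ (content-multiple Q′ eqQ))))
         (trans (solve 5 (λ r s k m w → r :* s :* (k :* m :* w) := (r :* k) :* (s :* m) :* w) refl r s κ μ D′)
           (trans (cong₂ (λ u v → u * v * D′) (proj₂ (proj₂ κ-unit)) (proj₂ (proj₂ μ-unit))) (*-identityˡ D′)))

-- Primitive coordinates of rational points

record Coordinates (P : Point) : Set where
  field
    vector : Primitive
    scale  : ℚ
    scale≢0 : scale ≢ 0ℚ
    x≡     : Point.x P ≡ scale * aℚ vector
    y≡     : Point.y P ≡ scale * bℚ vector

coordinates : ∀ P → Coordinates P
coordinates (point x y nz) = clear (primitive-part X Y XY≢0)
  where
  open ≡-Reasoning
  open +-*-Solver
  X = ↥ x ℤ.* ↧ y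
  Y = ↥ y ℤ.* ↧ x
  N = ι (↧ x) * ι (↧ y)

  ι↧≢0 : ∀ q → ι (↧ q) ≢ 0ℚ
  ι↧≢0 q eq with () ← ι≡0⇒≡0 eq

  N≢0 : N ≢ 0ℚ
  N≢0 = *-≢0 (ι↧≢0 x) (ι↧≢0 y)

  xN≡X : x * N ≡ ι X
  xN≡X = begin
    x * (ι (↧ x) * ι (↧ y)) ≡⟨ *-assoc x (ι (↧ x)) (ι (↧ y)) ⟨
    x * ι (↧ x) * ι (↧ y)   ≡⟨ cong (_* ι (↧ y)) (*-↧ x) ⟩
    ι (↥ x) * ι (↧ y)       ≡⟨ ι-* (↥ x) (↧ y) ⟨
    ι X                     ∎

  yN≡Y : y * N ≡ ι Y
  yN≡Y = begin
    y * (ι (↧ x) * ι (↧ y)) ≡⟨ solve 3 (λ y a b → y :* (a :* b) := y :* b :* a) refl y (ι (↧ x)) (ι (↧ y)) ⟩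
    y * ι (↧ y) * ι (↧ x)   ≡⟨ cong (_* ι (↧ x)) (*-↧ y) ⟩
    ι (↥ y) * ι (↧ x)       ≡⟨ ι-* (↥ y) (↧ x) ⟨
    ι Y                     ∎

  vanish : ∀ {z Z} → z * N ≡ ι Z → Z ≡ 0ℤ → z ≡ 0ℚ
  vanish eq refl = *-cancelʳ-≢0 N≢0 (trans eq (trans ι-0 (sym (*-zeroˡ N))))

  XY≢0 : ¬ (X ≡ 0ℤ × Y ≡ 0ℤ)
  XY≢0 (X≡0 , Y≡0) = nz (vanish xN≡X X≡0 , vanish yN≡Y Y≡0)

  clear : ∃[ g ] (g ≢ 0ℤ × ∃[ V ] (X ≡ g ℤ.* Primitive.a V × Y ≡ g ℤ.* Primitive.b V)) → Coordinates (point x y nz)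
  clear (g , g≢0 , V , X≡ , Y≡) = record { vector = V ; scale = c ; scale≢0 = c≢0 ; x≡ = scaled xN≡X X≡ ; y≡ = scaled yN≡Y Y≡ }
    where
    c = proj₁ (quotient-exists (ι g) N≢0)
    cN≡g : c * N ≡ ι g
    cN≡g = proj₂ (quotient-exists (ι g) N≢0)
    c≢0 : c ≢ 0ℚ
    c≢0 c≡0 = g≢0 (ι≡0⇒≡0 (trans (sym cN≡g) (trans (cong (_* N) c≡0) (*-zeroˡ N))))
    scaled : ∀ {z Z k} → z * N ≡ ι Z → Z ≡ g ℤ.* k → z ≡ c * ι k
    scaled {z} {Z} {k} zN≡Z refl = *-cancelʳ-≢0 N≢0 (begin
      z * N       ≡⟨ zN≡Z ⟩
      ι Z         ≡⟨ ι-* g k ⟩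
      ι g * ι k   ≡⟨ cong (_* ι k) cN≡g ⟨
      c * N * ι k ≡⟨ solve 3 (λ c n k → c :* n :* k := c :* k :* n) refl c N (ι k) ⟩
      c * ι k * N ∎)

vector : Point → Primitive
vector P = Coordinates.vector (coordinates P)

cross-∼ : ∀ P Q → P ∼ Q → cross (vector P) (vector Q) ≡ 0ℤ
cross-∼ P Q (k , k≢0 , x≡ , y≡) = ι≡0⇒≡0 (*-cancelʳ-≢0 (Coordinates.scale≢0 CQ) (begin
  ι (cross V W) * d                     ≡⟨ cong (_* d) (crossℚ V W) ⟩
  (aℚ V * bℚ W + - (bℚ V * aℚ W)) * d   ≡⟨ solve 5 (λ a b a′ b′ d → (a :* b′ :- b :* a′) :* d := a :* (d :* b′) :- b :* (d :* a′)) refl (aℚ V) (bℚ V) (aℚ W) (bℚ W) d ⟩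
  aℚ V * (d * bℚ W) + - (bℚ V * (d * aℚ W)) ≡⟨ cong₂ (λ s t → aℚ V * s + - (bℚ V * t)) dbW daW ⟩
  aℚ V * (k * (c * bℚ V)) + - (bℚ V * (k * (c * aℚ V))) ≡⟨ solve 5 (λ a b k c d → a :* (k :* (c :* b)) :- b :* (k :* (c :* a)) := con 0ℚ :* d) refl (aℚ V) (bℚ V) k c d ⟩
  0ℚ * d ∎))
  where
  open ≡-Reasoning
  open +-*-Solver
  CP = coordinates P
  CQ = coordinates Q
  V = vector P
  W = vector Q
  c = Coordinates.scale CP
  d = Coordinates.scale CQ
  daW : d * aℚ W ≡ k * (c * aℚ V)
  daW = trans (sym (Coordinates.x≡ CQ)) (trans x≡ (cong (k *_) (Coordinates.x≡ CP)))
  dbW : d * bℚ W ≡ k * (c * bℚ V)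
  dbW = trans (sym (Coordinates.y≡ CQ)) (trans y≡ (cong (k *_) (Coordinates.y≡ CP)))

cross≡0⇒∼ : ∀ P Q → cross (vector P) (vector Q) ≡ 0ℤ → P ∼ Q
cross≡0⇒∼ P Q cross≡0 = k , k≢0 , coordinate (Coordinates.x≡ CP) (Coordinates.x≡ CQ) (proj₁ (content-multiple V eq)) ,
                               coordinate (Coordinates.y≡ CP) (Coordinates.y≡ CQ) (proj₂ (content-multiple V eq))
  where
  open ≡-Reasoning
  open +-*-Solver
  CP = coordinates P
  CQ = coordinates Q
  V = vector P
  W = vector Q
  c = Coordinates.scale CP
  d = Coordinates.scale CQ
  w = content V (aℚ W) (bℚ W)

  eq : aℚ V * bℚ W ≡ bℚ V * aℚ W
  eq = trans (solve 2 (λ s t → s := s :- t :+ t) refl (aℚ V * bℚ W) (bℚ V * aℚ W))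
    (trans (cong (_+ bℚ V * aℚ W) (trans (sym (crossℚ V W)) (trans (cong ι cross≡0) ι-0))) (+-identityˡ (bℚ V * aℚ W)))

  k = proj₁ (quotient-exists (d * w) (Coordinates.scale≢0 CP))
  kc≡dw : k * c ≡ d * w
  kc≡dw = proj₂ (quotient-exists (d * w) (Coordinates.scale≢0 CP))

  coordinate : ∀ {s t i j} → s ≡ c * i → t ≡ d * j → j ≡ w * i → t ≡ k * s
  coordinate {i = i} refl refl refl = trans (sym (*-assoc d w i)) (trans (cong (_* i) (sym kc≡dw)) (*-assoc k c i))

  k≢0 : k ≢ 0ℚ
  k≢0 k≡0 = Point.nonzero Q (vanish (coordinate (Coordinates.x≡ CP) (Coordinates.x≡ CQ) (proj₁ (content-multiple V eq))) ,
                             vanish (coordinate (Coordinates.y≡ CP) (Coordinates.y≡ CQ) (proj₂ (content-multiple V eq))))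
    where
    vanish : ∀ {s t} → t ≡ k * s → t ≡ 0ℚ
    vanish {s} eq = trans eq (trans (cong (_* s) k≡0) (*-zeroˡ s))

image : Endomorphism → Point → Point
image φ = Func.to ⟦ φ ⟧

-- Cross-multiplied, because the factor of proportionality depends on the model ψ, while the vectors
-- `V` and `W` depend on φ alone and serve for all primes.
vector-image : ∀ {φ ψ} → φ ≈ᴱ ψ → ∀ P → let V = vector P ; W = vector (image φ P) ; open Endomorphism ψ in
               aℚ W * eval G (aℚ V) (bℚ V) ≡ bℚ W * eval F (aℚ V) (bℚ V)
vector-image {φ} {ψ} φ≈ψ P@(point x y nz) = *-cancelʳ-≢0 (*-≢0 (Coordinates.scale≢0 CQ) (^-≢0 (Coordinates.scale≢0 CP) n)) (begin
  aℚ W * g * (d * c ^ n)          ≡⟨ solve 4 (λ a g d c → a :* g :* (d :* c) := (d :* a) :* (c :* g)) refl (aℚ W) g d (c ^ n) ⟩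
  (d * aℚ W) * (c ^ n * g)        ≡⟨ cong₂ _*_ (Coordinates.x≡ CQ) (at-P (G ψ)) ⟨
  eval (F φ) x y * eval (G ψ) x y ≡⟨ ≈ᴱ⇒proportional x y {φ} {ψ} φ≈ψ ⟩
  eval (G φ) x y * eval (F ψ) x y ≡⟨ cong₂ _*_ (Coordinates.y≡ CQ) (at-P (F ψ)) ⟩
  (d * bℚ W) * (c ^ n * f)        ≡⟨ solve 4 (λ b f d c → (d :* b) :* (c :* f) := b :* f :* (d :* c)) refl (bℚ W) f d (c ^ n) ⟩
  bℚ W * f * (d * c ^ n)          ∎)
  where
  open Endomorphism using (F; G; degree)
  open ≡-Reasoning
  open +-*-Solver
  CP = coordinates P
  CQ = coordinates (image φ P)
  V = vector P
  W = vector (image φ P)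
  c = Coordinates.scale CP
  d = Coordinates.scale CQ
  n = degree ψ
  f = eval (F ψ) (aℚ V) (bℚ V)
  g = eval (G ψ) (aℚ V) (bℚ V)
  at-P : ∀ (H : Form n) → eval H x y ≡ c ^ n * eval H (aℚ V) (bℚ V)
  at-P H = trans (cong₂ (eval H) (Coordinates.x≡ CP) (Coordinates.y≡ CP)) (eval-scale H c (aℚ V) (bℚ V))

separation-image : ∀ φ → (∀ p → Prime p → GoodReduction φ p) → ∀ P Q →
  separation (vector P) (vector Q) ℕ.∣ separation (vector (image φ P)) (vector (image φ Q))
separation-image φ good P Q = locally-divides⇒∣ λ p p-prime → local p p-prime (good p p-prime)
  where
  local : ∀ p → Prime p → GoodReduction φ p →
    ∃[ s ] (s ∈ℤ₍ p ₎ × s * ι (cross (vector P) (vector Q)) ≡ ι (cross (vector (image φ P)) (vector (image φ Q))))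
  local p p-prime (ψ , φ≈ψ , F∈ , G∈ , Res∈ , r , r∈ , Res*r≡1) =
    let s , s∈ , eq = cross-multiple (F ψ) (G ψ) (coprime ψ) F∈ G∈ Res∉𝔪 (vector P) (vector Q)
                        (vector (image φ P)) (vector (image φ Q)) (vector-image {φ} {ψ} φ≈ψ P) (vector-image {φ} {ψ} φ≈ψ Q)
    in s , s∈ , sym eq
    where
    open Endomorphism using (F; G; coprime)
    open LocalStep p-prime
    open Localization p-prime
    Res∉𝔪 : ¬ 𝔪 (Res (F ψ) (G ψ))
    Res∉𝔪 Res∈𝔪 = 1∉𝔪 (subst 𝔪 Res*r≡1 (IsIdeal.multiple∈ʳ (Multiple-isIdeal (ι (+ p))) {r} r∈ Res∈𝔪))

-- Function.Endo.Setoid composes from left to right: iterate φ (suc n) P is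
-- iterate φ n (image φ P) by computation.
iterate-suc : ∀ φ n P → iterate φ (suc n) P ≡ image φ (iterate φ n P)
iterate-suc φ zero    P = refl
iterate-suc φ (suc n) P = iterate-suc φ n (image φ P)

iterate-+ : ∀ φ m n P → iterate φ (m ℕ.+ n) P ≡ iterate φ n (iterate φ m P)
iterate-+ φ zero    n P = refl
iterate-+ φ (suc m) n P = iterate-+ φ m n (image φ P)

iterate-cong : ∀ φ n {P Q} → P ∼ Q → iterate φ n P ∼ iterate φ n Q
iterate-cong φ zero            P∼Q = P∼Q
iterate-cong φ (suc n) {P} {Q} P∼Q = iterate-cong φ n {image φ P} {image φ Q} (Func.cong ⟦ φ ⟧ {P} {Q} P∼Q)

-- From distances back to periods and orbits

module Orbits (φ : Endomorphism) (good : ∀ p → Prime p → GoodReduction φ p) (P : Point) where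
  open Setoid ℙ¹ using () renaming (refl to ∼-refl; sym to ∼-sym; trans to ∼-trans)

  distance : ℕ → ℕ → ℕ
  distance i j = separation (vector (iterate φ i P)) (vector (iterate φ j P))

  distance-isDistance : IsDistance distance
  distance-isDistance = separation-isDistance (λ i → vector (iterate φ i P))
    λ i j → subst₂ (λ Q R → distance i j ℕ.∣ separation (vector Q) (vector R))
      (sym (iterate-suc φ i P)) (sym (iterate-suc φ j P)) (separation-image φ good (iterate φ i P) (iterate φ j P))

  ∼⇒distance≡0 : ∀ i j → iterate φ i P ∼ iterate φ j P → distance i j ≡ 0
  ∼⇒distance≡0 i j eq = cong ∣_∣ (cross-∼ (iterate φ i P) (iterate φ j P) eq)

  distance≡0⇒∼ : ∀ i j → distance i j ≡ 0 → iterate φ i P ∼ iterate φ j P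
  distance≡0⇒∼ i j eq = cross≡0⇒∼ (iterate φ i P) (iterate φ j P) (ℤ.∣i∣≡0⇒i≡0 eq)

  minimal-period≤3 : ∀ n → HasMinimalPeriod φ P n → n ℕ.≤ 3
  minimal-period≤3 n period = period≤3 distance-isDistance positive record
    { returns = ∼⇒distance≡0 0 n (∼-sym {iterate φ n P} {P} returns)
    ; minimal = λ {m} 0<m m<n eq → ℕ.<⇒≱ m<n (minimal m 0<m (∼-sym {P} {iterate φ m P} (distance≡0⇒∼ 0 m eq)))
    }
    where open HasMinimalPeriod period

  repeats : Preperiodic φ P → ∃[ n ] Repeats distance n
  repeats (Q , (m , Pₘ∼Q) , n , 0<n , φⁿQ∼Q) = m ℕ.+ n , m , ℕ.m<m+n m 0<n , ∼⇒distance≡0 m (m ℕ.+ n)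
    (subst (Pₘ ∼_) (sym (iterate-+ φ m n P))
      (∼-trans {Pₘ} {Q} {iterate φ n Pₘ} Pₘ∼Q
        (∼-trans {Q} {iterate φ n Q} {iterate φ n Pₘ} (∼-sym {iterate φ n Q} {Q} φⁿQ∼Q)
          (iterate-cong φ n {Q} {Pₘ} (∼-sym {Pₘ} {Q} Pₘ∼Q)))))
    where Pₘ = iterate φ m P

  -- A point beyond the first repetition k ~ j also occurs k - j steps earlier.
  occurs-before : ∀ {k} → Repeats distance k → ∀ m → ∃[ i ] (i ℕ.< k × iterate φ i P ∼ iterate φ m P)
  occurs-before {k} (j , j<k , djk≡0) = <-rec _ search
    where
    search : ∀ m → (∀ {l} → l ℕ.< m → ∃[ i ] (i ℕ.< k × iterate φ i P ∼ iterate φ l P)) →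
             ∃[ i ] (i ℕ.< k × iterate φ i P ∼ iterate φ m P)
    search m rec with m ℕ.<? k
    ... | yes m<k = m , m<k , ∼-refl {iterate φ m P}
    ... | no m≮k = let i , i<k , eq = rec l<m in
        i , i<k , ∼-trans {iterate φ i P} {iterate φ l P} {iterate φ m P} eq Pₗ∼Pₘ
      where
      r = m ℕ.∸ k
      l = j ℕ.+ r
      k+r≡m : k ℕ.+ r ≡ m
      k+r≡m = ℕ.m+[n∸m]≡n (ℕ.≮⇒≥ m≮k)
      l<m : l ℕ.< m
      l<m = subst (l ℕ.<_) k+r≡m (ℕ.+-monoˡ-< r j<k)
      Pₗ∼Pₘ : iterate φ l P ∼ iterate φ m P
      Pₗ∼Pₘ = subst₂ _∼_ (sym (iterate-+ φ j r P)) (trans (sym (iterate-+ φ k r P)) (cong (λ n → iterate φ n P) k+r≡m))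
        (iterate-cong φ r {iterate φ j P} {iterate φ k P} (distance≡0⇒∼ j k djk≡0))

  -- The iterates below the first repetition enumerate the orbit: distinctness gives injectivity and
  -- `occurs-before` surjectivity.
  orbit-cardinality : ∀ {k} → Repeats distance k → (∀ {i j} → i ℕ.< j → j ℕ.< k → distance i j ≢ 0) →
                      HasCardinality (Orbit φ P) k
  orbit-cardinality {k} repeat distinct = record
    { to        = λ i → iterate φ (toℕ i) P , toℕ i , ∼-refl {iterate φ (toℕ i) P}
    ; cong      = λ { {i} refl → ∼-refl {iterate φ (toℕ i) P} }
    ; bijective = (λ {i} {j} → injective i j) , surjective
    }
    where
    injective : ∀ (i j : Fin k) → iterate φ (toℕ i) P ∼ iterate φ (toℕ j) P → i ≡ j
    injective i j eq with ℕ.<-cmp (toℕ i) (toℕ j)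
    ... | tri< i<j _ _ = contradiction (∼⇒distance≡0 (toℕ i) (toℕ j) eq) (distinct i<j (Fin.toℕ<n j))
    ... | tri≈ _ i≡j _ = Fin.toℕ-injective i≡j
    ... | tri> _ _ j<i = contradiction
      (∼⇒distance≡0 (toℕ j) (toℕ i) (∼-sym {iterate φ (toℕ i) P} {iterate φ (toℕ j) P} eq)) (distinct j<i (Fin.toℕ<n i))

    surjective : ∀ (Q : Setoid.Carrier (Orbit φ P)) →
                 ∃[ i ] (∀ {j : Fin k} → j ≡ i → iterate φ (toℕ j) P ∼ proj₁ Q)
    surjective (Q , m , Pₘ∼Q) with i , i<k , Pᵢ∼Pₘ ← occurs-before repeat m = fromℕ< i<k , λ where
      refl → subst (λ n → iterate φ n P ∼ Q) (sym (Fin.toℕ-fromℕ< i<k))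
        (∼-trans {iterate φ i P} {iterate φ m P} {Q} Pᵢ∼Pₘ Pₘ∼Q)

  orbit≤12 : Preperiodic φ P → ∃[ k ] (k ℕ.≤ 12 × HasCardinality (Orbit φ P) k)
  orbit≤12 preperiodic =
    let k , k≤12 , repeat , distinct = first-repeat≤12 distance-isDistance (proj₂ (repeats preperiodic))
    in k , k≤12 , orbit-cardinality repeat distinct

corollary1p2 : (φ : Endomorphism) →
    (∀ (p : ℕ) → Prime p → GoodReduction φ p) →
    (∀ (P : Point) (n : ℕ) → HasMinimalPeriod φ P n → n ≤ 3)
    ×
    (∀ (P : Point) → Preperiodic φ P → ∃[ k ] (k ≤ 12 × HasCardinality (Orbit φ P) k))
corollary1p2 φ good = (λ P → Orbits.minimal-period≤3 φ good P) , (λ P → Orbits.orbit≤12 φ good P)
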